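{- Let $p$ be an odd prime and $n$ a positive integer. Let $f_0 \in \mathrm{Irr}_p(n)$, and let $\nu_2(p^n-1) = e_0$ and $\nu_2(p^{2n}-1) = e_1$, where $e_0, e_1$ are positive integers with $e_0 < e_1$. Let $\{f_i\}_{i \ge 0}$ be any sequence of polynomials constructed from $f_0$ as follows. If $f_0^R$ is irreducible, then $f_1 := f_0^R$. Otherwise, $f_1$ is one of the two monic irreducible factors of degree $n$ of $f_0^R$, chosen so that $f_1$ has a root which is not $\vartheta_{1/2}$-periodic. For $i \ge 2$, inductively: if $f_{i-1}^R$ is irreducible, then $f_i := f_{i-1}^R$; otherwise, $f_i$ is one of the two monic irreducible factors of $f_{i-1}^R$ of degree $\deg f_{i-1}$ (either choice is allowed). Then there exist two positive integers $s_1, s_2$ such that: (1) $f_0, \dots, f_{s_1-1} \in \mathrm{Irr}_p(n)$; (2) $f_{s_1}, \dots, f_{s_1+s_2-1} \in \mathrm{Irr}_p(2n)$; (3) $f_{s_1+s_2+j} \in \mathrm{Irr}_p(2^{2+j} n)$ for every integer $j \ge 0$; (4) $s_1 \le e_0+1$ and $s_2 = e_1-e_0$.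
   Context: Let $\mathbf{F}_p$ be the field with $p$ elements. For a positive integer $m$, $\mathrm{Irr}_p(m)$ denotes the set of all monic irreducible polynomials of degree $m$ in $\mathbf{F}_p[x]$ different from $x+1$ and $x-1$. For a positive integer $m = 2^e k$ with $k$ odd and $e \ge 0$, $\nu_2(m) = e$. For a monic polynomial $f \in \mathbf{F}_p[x]$ of degree $m$, $f^R$ denotes the monic polynomial of degree $2m$ given by $f^R(x) = (2x)^m \cdot f\left(\frac{1}{2}(x+x^{ -1})\right)$. For a finite extension $\mathbf{F}_q$ of $\mathbf{F}_p$, the map $\vartheta_{1/2}$ on $\mathbf{P}^1(\mathbf{F}_q) = \mathbf{F}_q \cup \{\infty\}$ is defined by $\vartheta_{1/2}(x) = \infty$ if $x \in \{0,\infty\}$ and $\vartheta_{1/2}(x) = \frac{1}{2}(x+x^{ -1})$ otherwise. An element $x$ is $\vartheta_{1/2}$-periodic if $\vartheta_{1/2}^k(x) = x$ for some positive integer $k$ (where $\vartheta_{1/2}^k$ is the $k$-fold iterate). The construction is meaningful because of the following fact: for $f \in \mathrm{Irr}_p(m)$, either $f^R \in \mathrm{Irr}_p(2m)$, or $f^R$ is the product of two polynomials of $\mathrm{Irr}_p(m)$ which are the minimal polynomials over $\mathbf{F}_p$ of $\alpha$ and $\alpha^{ -1}$ for some $\alpha \in \mathbf{F}_{p^m}$, and in the latter case at least one among $\alpha$ and $\alpha^{ -1}$ is not $\vartheta_{1/2}$-periodic. -}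

module Defs where

open import Level using (0ℓ)
open import Algebra.Bundles using (CommutativeRing)
open import Algebra.Bundles.Raw using (RawSemiring)
open import Algebra.Core using (Op₁)
import Algebra.Definitions.RawSemiring
open import Algebra.Morphism.Structures using (IsRingHomomorphism)
open import Data.Bool.Base using (if_then_else_)
open import Data.Fin.Base using (Fin; toℕ)
open import Data.List.Base using (List; []; _∷_; map; foldr)
open import Data.List.Relation.Unary.All using (all?)
open import Data.Maybe.Base using (Maybe; just; nothing)
open import Data.Maybe.Relation.Binary.Pointwise using (Pointwise)
open import Data.Nat.Base as ℕ using (ℕ; zero; suc; _∸_; _<_)
open import Data.Nat.Divisibility using () renaming (_∤_ to _∤ℕ_)
open import Data.Nat.GeneralisedArithmetic using (iterate)
open import Data.Product.Base using (∃-syntax; _×_)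
open import Function.Bundles using (Inverse)
open import Relation.Binary.Definitions using (Decidable)
open import Relation.Binary.PropositionalEquality using (_≡_; setoid)
open import Relation.Nullary.Decidable.Core using (does; yes; no)
open import Relation.Nullary.Negation.Core using (¬_)

-- ν₂ m ≈ e  is the graph of the 2-adic valuation on positive integers.
infix 4 ν₂_≈_

ν₂_≈_ : ℕ → ℕ → Set
ν₂ m ≈ e = ∃[ k ] (2 ∤ℕ k × m ≡ 2 ℕ.^ e ℕ.* k)

-- Fields with decidable equality.  The inverse is total; its value at 0#
-- is unconstrained and never used below in odd characteristic.
record Field : Set₁ where
  infix  4 _≟_
  infixl 9 _⁻¹
  field
    commutativeRing : CommutativeRing 0ℓ 0ℓ
  open CommutativeRing commutativeRing public
  field
    _≟_      : Decidable _≈_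
    0≉1      : 0# ≉ 1#
    _⁻¹      : Op₁ Carrier
    ⁻¹-cong  : ∀ {x y} → x ≈ y → x ⁻¹ ≈ y ⁻¹
    inverseʳ : ∀ {x} → x ≉ 0# → x * x ⁻¹ ≈ 1#

  2# : Carrier
  2# = 1# + 1#

HasCardinality : Field → ℕ → Set
HasCardinality F q = Inverse (Field.setoid F) (setoid (Fin q))

-- For F finite, an extension of F has finite degree exactly when it has
-- finitely many elements.
record FiniteExtension (F : Field) : Set₁ where
  field
    K                  : Field
    embed              : Field.Carrier F → Field.Carrier K
    isRingHomomorphism : IsRingHomomorphism (Field.rawRing F) (Field.rawRing K) embed
    q                  : ℕ
    cardinality        : HasCardinality K q

-- The map x ↦ ½ (x + x⁻¹) on the projective line; nothing is the point at
-- infinity.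
module ProjectiveLine (K : Field) where
  open Field K

  P¹ : Set
  P¹ = Maybe Carrier

  infix 4 _≈∞_
  _≈∞_ : P¹ → P¹ → Set
  _≈∞_ = Pointwise _≈_

  ϑ : P¹ → P¹
  ϑ nothing  = nothing
  ϑ (just x) with x ≟ 0#
  ... | yes _ = nothing
  ... | no  _ = just (2# ⁻¹ * (x + x ⁻¹))

  Periodic : P¹ → Set
  Periodic x = ∃[ k ] (0 < k × iterate ϑ x k ≈∞ x)

module Polynomials (F : Field) where
  open Field F using (Carrier; _≈_; _+_; _*_; -_; 0#; 1#; 2#; _≟_)

  -- Coefficient lists, constant term first.  Trailing zeros are allowed, so
  -- equality is coefficientwise.
  Poly : Set
  Poly = List Carrier

  coeff : Poly → ℕ → Carrier
  coeff []      _       = 0#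
  coeff (a ∷ f) zero    = a
  coeff (a ∷ f) (suc i) = coeff f i

  infix  4 _≈ₚ_
  infixl 6 _+ₚ_
  infixl 7 _*ₚ_

  _≈ₚ_ : Poly → Poly → Set
  f ≈ₚ g = ∀ i → coeff f i ≈ coeff g i

  _+ₚ_ : Poly → Poly → Poly
  []      +ₚ g       = g
  (a ∷ f) +ₚ []      = a ∷ f
  (a ∷ f) +ₚ (b ∷ g) = a + b ∷ f +ₚ g

  _*ₚ_ : Poly → Poly → Poly
  []      *ₚ g = []
  (a ∷ f) *ₚ g = map (a *_) g +ₚ (0# ∷ f *ₚ g)

  rawSemiring : RawSemiring 0ℓ 0ℓ
  rawSemiring = record
    { Carrier = Poly
    ; _≈_     = _≈ₚ_
    ; _+_     = _+ₚ_
    ; _*_     = _*ₚ_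
    ; 0#      = []
    ; 1#      = 1# ∷ []
    }

  open Algebra.Definitions.RawSemiring rawSemiring public
    using (_∣_; Irreducible; sum; _^_)

  -- The zero polynomial is given degree 0.
  degree : Poly → ℕ
  degree []      = 0
  degree (a ∷ f) = if does (all? (_≟ 0#) f) then 0 else suc (degree f)

  Monic : Poly → Set
  Monic f = coeff f (degree f) ≈ 1#

  record Irr (m : ℕ) (f : Poly) : Set where
    field
      monic       : Monic f
      degree≡m    : degree f ≡ m
      irreducible : Irreducible f
      ≉x+1        : ¬ (f ≈ₚ 1# ∷ 1# ∷ [])
      ≉x-1        : ¬ (f ≈ₚ - 1# ∷ 1# ∷ [])

  -- For f = Σ aᵢ xⁱ of degree m, expanding (2x)ᵐ f(½(x + x⁻¹)) with
  -- 2x · ½(x + x⁻¹) = x² + 1 gives  Σ aᵢ (2x)ᵐ⁻ⁱ (x² + 1)ⁱ.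
  infix 9 _^R
  _^R : Poly → Poly
  f ^R = sum {suc m} λ i →
    (coeff f (toℕ i) ∷ []) *ₚ (0# ∷ 2# ∷ []) ^ (m ∸ toℕ i) *ₚ (1# ∷ 0# ∷ 1# ∷ []) ^ toℕ i
    where m = degree f

  -- Successor f g: a sequence may continue from f with g.  Either of the two
  -- factors of a reducible f ^R is allowed.
  data Successor (f g : Poly) : Set where
    whole  : Irreducible (f ^R) → g ≈ₚ f ^R → Successor f g
    factor : ¬ Irreducible (f ^R) →
             Monic g → Irreducible g → degree g ≡ degree f → g ∣ f ^R →
             Successor f g

  module _ (E : FiniteExtension F) where
    open FiniteExtension E
    private module K = Field K

    eval : Poly → K.Carrier → K.Carrier
    eval f α = foldr (λ a r → embed a K.+ α K.* r) K.0# f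

    NonPeriodicRoot : Poly → K.Carrier → Set
    NonPeriodicRoot f α = eval f α K.≈ K.0# × ¬ ProjectiveLine.Periodic K (just α)

  HasNonPeriodicRoot : Poly → Set₁
  HasNonPeriodicRoot f = ∃[ E ] ∃[ α ] NonPeriodicRoot E f α

{-# OPTIONS --safe #-}
module Submission where

-- The Möbius map ψ(x) = (x − 1)/(x + 1) satisfies ψ(½(x + x⁻¹)) = ψ(x)².  So, if β is a root of a
-- factor g of f ^R, then θ = ½(β + β⁻¹) is a root of f, and the unit ψ(β) of g is a square root of
-- the unit ψ(θ) of f: the sequence is a chain of square roots.  Once the order of a unit is even,
-- every step raises the 2-adic valuation a of the order by one.  Let f have degree d and q = pᵈ;
-- then a ≤ ν₂(q − 1) by Fermat.  If f ^R has a factor of degree d, the same bound holds for the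
-- next unit, so a < ν₂(q − 1).  If f ^R is irreducible, its unit v satisfies v^(q − 1) ≠ 1, since
-- otherwise y^q = y would have more than q solutions; so a = ν₂(q − 1).  Hence the degree doubles
-- exactly when a reaches ν₂(pᵈ − 1), which is e₀ and e₁ for d = n and 2n and grows by one with every
-- further doubling.  If the unit of f₀ has odd order, then f₀ ^R is reducible; as units of odd order
-- belong to periodic points, the unit of f₁ has even order, and a = 1 there.

-- The roots of consecutive polynomials lie in unrelated residue fields F[x]/(f), and neither a
-- common closure nor an embedding between these fields is constructed. What passes from one field
-- to the next is divisibility in F[x]: `Level f N c` says that f divides (x - 1)^N - c (x + 1)^N,
-- that is, ψ(β)^N = c at every root β of f in every extension. Likewise the field of θ is met
-- inside the field of β only as the set of values h(θ) of polynomials h. Orders of units are never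
-- computed. A single odd k, the odd part of p^n - 1, serves in all degrees d = n, 2n, 4n, ...,
-- because it divides the odd part of each p^d - 1. The order of a unit u is located by the equation
-- u^(2^a k) = -1; this index a is one less than the valuation a of the overview. The polynomials x
-- + 1 and x - 1 are excluded because -1 and 1 are the pole and the zero of ψ. Both points are fixed
-- by x ↦ ½(x + x⁻¹), so a factor of `f ^R` can have such a root only if f has it.

open import Level using (0ℓ)
open import Algebra.Bundles using (CommutativeMonoid; CommutativeRing)
open import Algebra.Morphism.Structures using (IsRingHomomorphism)
open import Algebra.Solver.Ring.AlmostCommutativeRing using (fromCommutativeRing; _-Raw-AlmostCommutative⟶_)
open import Data.Empty using (⊥)
open import Data.Fin.Base as Fin using (Fin; toℕ; fromℕ<; punchIn; combine; funToFin; finToFun)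
open import Data.Fin.Permutation using (Permutation; permutation; remove; _⟨$⟩ʳ_; punchIn-permute)
open import Data.Fin.Properties using (punchInᵢ≢i; pigeonhole; toℕ<n; toℕ-fromℕ; toℕ-fromℕ<; funToFin-finToFin; finToFun-funToFin)
open import Data.Integer.Base as ℤ using (ℤ; -[1+_]) renaming (+_ to pos)
import Data.Integer.Properties as ℤₚ
open import Data.List.Base using (List; []; _∷_; map; tabulate)
open import Data.List.Relation.Unary.All as All using (All; all?)
open import Data.Maybe.Base as Maybe using (just)
open import Data.Maybe.Relation.Binary.Pointwise using (just)
open import Data.Nat.Base as ℕ using (ℕ; zero; suc; _≤_; _<_; _∸_; s≤s; z≤n)
open import Data.Nat.Coprimality using (Coprime; coprime-divisor)
open import Data.Nat.Divisibility using (∣1⇒≡1; ∣n⇒∣m*n; ∣m⇒∣m*n; ∣m+n∣m⇒∣n; m∣m*n; n∣m*n) renaming (_∣_ to _∣ℕ_; _∤_ to _∤ℕ_; divides to dividesℕ)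
open import Data.Nat.GeneralisedArithmetic using (iterate)
open import Data.Nat.Primality using (Prime; prime[2]; euclidsLemma; prime⇒irreducible; prime⇒nonZero)
import Data.Nat.Properties as ℕₚ
open import Data.Nat.Tactic.RingSolver using (solve-∀)
open import Data.Product.Base using (∃-syntax; _×_; _,_; proj₁; proj₂)
open import Data.Sum.Base using (_⊎_; inj₁; inj₂)
open import Data.Vec.Base as Vec using (Vec)
open import Function.Base using (_∘_)
open import Function.Bundles using (Inverse)
open import Relation.Binary.Bundles using (Setoid)
open import Relation.Binary.Consequences using (dec⇒weaklyDec)
open import Relation.Binary.Definitions using (Decidable)
open import Relation.Binary.PropositionalEquality as ≡ using (_≡_; _≢_)
open import Relation.Nullary using (Dec; ¬_; yes; no; contradiction; map′)
open import Defs

-- A ring solver with integer coefficients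

module IntegerCoefficientSolver (R : CommutativeRing 0ℓ 0ℓ) where
  open CommutativeRing R hiding (zero)
  open import Algebra.Properties.Ring ring
  open import Algebra.Properties.AbelianGroup +-abelianGroup using (⁻¹-∙-comm)
  open import Algebra.Properties.Semiring.Mult.TCOptimised semiring using (1+×; ×-homo-+; ×1-homo-*) renaming (_×_ to _·_)
  open import Relation.Binary.Reasoning.Setoid setoid

  private
    fromℕ : ℕ → Carrier
    fromℕ n = n · 1#

  fromℤ : ℤ → Carrier
  fromℤ (pos n)  = fromℕ n
  fromℤ -[1+ n ] = - fromℕ (suc n)

  private
    a-b≈[c+a]-[c+b] : ∀ a b c → a - b ≈ (c + a) - (c + b)
    a-b≈[c+a]-[c+b] a b c = sym (begin
      (c + a) - (c + b)        ≈⟨ +-congˡ (⁻¹-∙-comm c b) ⟨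
      (c + a) + (- c + - b)    ≈⟨ +-congʳ (+-comm c a) ⟩
      (a + c) + (- c + - b)    ≈⟨ +-assoc a c _ ⟩
      a + (c + (- c + - b))    ≈⟨ +-congˡ (+-assoc c (- c) (- b)) ⟨
      a + ((c - c) + - b)      ≈⟨ +-congˡ (+-congʳ (-‿inverseʳ c)) ⟩
      a + (0# + - b)           ≈⟨ +-congˡ (+-identityˡ _) ⟩
      a - b                    ∎)

  ⊖-homo : ∀ m n → fromℤ (m ℤ.⊖ n) ≈ fromℕ m - fromℕ n
  ⊖-homo m       zero    = sym (trans (+-congˡ -0#≈0#) (+-identityʳ _))
  ⊖-homo zero    (suc n) = sym (+-identityˡ _)
  ⊖-homo (suc m) (suc n) = begin
    fromℤ (suc m ℤ.⊖ suc n)              ≡⟨ ≡.cong fromℤ (ℤₚ.[1+m]⊖[1+n]≡m⊖n m n) ⟩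
    fromℤ (m ℤ.⊖ n)                      ≈⟨ ⊖-homo m n ⟩
    fromℕ m - fromℕ n                    ≈⟨ a-b≈[c+a]-[c+b] _ _ 1# ⟩
    (1# + fromℕ m) - (1# + fromℕ n)      ≈⟨ +-cong (sym (1+× m 1#)) (-‿cong (sym (1+× n 1#))) ⟩
    fromℕ (suc m) - fromℕ (suc n)        ∎

  +-homo : ∀ i j → fromℤ (i ℤ.+ j) ≈ fromℤ i + fromℤ j
  +-homo (pos m)  (pos n)  = ×-homo-+ 1# m n
  +-homo (pos m)  -[1+ n ] = ⊖-homo m (suc n)
  +-homo -[1+ m ] (pos n)  = trans (⊖-homo n (suc m)) (+-comm _ _)
  +-homo -[1+ m ] -[1+ n ] = begin
    - fromℕ (suc (suc (m ℕ.+ n)))          ≡⟨ ≡.cong (λ k → - fromℕ (suc k)) (ℕₚ.+-suc m n) ⟨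
    - fromℕ (suc m ℕ.+ suc n)              ≈⟨ -‿cong (×-homo-+ 1# (suc m) (suc n)) ⟩
    - (fromℕ (suc m) + fromℕ (suc n))      ≈⟨ ⁻¹-∙-comm _ _ ⟨
    - fromℕ (suc m) + - fromℕ (suc n)      ∎
    where import Data.Nat.Properties as ℕₚ

  -‿homo : ∀ i → fromℤ (ℤ.- i) ≈ - fromℤ i
  -‿homo (pos zero)    = sym -0#≈0#
  -‿homo (pos (suc n)) = refl
  -‿homo -[1+ n ]      = sym (-‿involutive _)

  *-homo : ∀ i j → fromℤ (i ℤ.* j) ≈ fromℤ i * fromℤ j
  *-homo i j = by-sign i
    where
    nonNeg : ∀ m n → fromℤ (pos m ℤ.* pos n) ≈ fromℕ m * fromℕ n
    nonNeg m n = trans (reflexive (≡.cong fromℤ (≡.sym (ℤₚ.pos-* m n)))) (×1-homo-* m n)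

    nonNegˡ : ∀ m j → fromℤ (pos m ℤ.* j) ≈ fromℕ m * fromℤ j
    nonNegˡ m (pos n)  = nonNeg m n
    nonNegˡ m -[1+ n ] = begin
      fromℤ (pos m ℤ.* -[1+ n ])        ≡⟨ ≡.cong fromℤ (ℤₚ.neg-distribʳ-* (pos m) (pos (suc n))) ⟨
      fromℤ (ℤ.- (pos m ℤ.* pos (suc n)))   ≈⟨ -‿homo (pos m ℤ.* pos (suc n)) ⟩
      - fromℤ (pos m ℤ.* pos (suc n))       ≈⟨ -‿cong (nonNeg m (suc n)) ⟩
      - (fromℕ m * fromℕ (suc n))     ≈⟨ -‿distribʳ-* _ _ ⟩
      fromℕ m * - fromℕ (suc n)       ∎

    by-sign : ∀ i → fromℤ (i ℤ.* j) ≈ fromℤ i * fromℤ j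
    by-sign (pos m)  = nonNegˡ m j
    by-sign -[1+ m ] = begin
      fromℤ (-[1+ m ] ℤ.* j)          ≡⟨ ≡.cong fromℤ (ℤₚ.neg-distribˡ-* (pos (suc m)) j) ⟨
      fromℤ (ℤ.- (pos (suc m) ℤ.* j))     ≈⟨ -‿homo (pos (suc m) ℤ.* j) ⟩
      - fromℤ (pos (suc m) ℤ.* j)         ≈⟨ -‿cong (nonNegˡ (suc m) j) ⟩
      - (fromℕ (suc m) * fromℤ j)     ≈⟨ -‿distribˡ-* _ _ ⟩
      - fromℕ (suc m) * fromℤ j       ∎

  private
    morphism : ℤ.+-*-rawRing -Raw-AlmostCommutative⟶ fromCommutativeRing R
    morphism = record
      { ⟦_⟧    = fromℤ
      ; +-homo = +-homo
      ; *-homo = *-homo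
      ; -‿homo = -‿homo
      ; 0-homo = refl
      ; 1-homo = refl
      }

  -- Coefficients are compared in ℤ, so the solver proves the identities valid in every commutative
  -- ring; the characteristic of `R` never enters.
  open import Algebra.Solver.Ring ℤ.+-*-rawRing (fromCommutativeRing R) morphism
    (λ i j → Maybe.map (λ i≡j → reflexive (≡.cong fromℤ i≡j)) (dec⇒weaklyDec ℤₚ._≟_ i j)) public
    using (Polynomial; solve; con; _:+_; _:*_; _:-_; :-_; _:=_)

  κ : ∀ {n} → ℕ → Polynomial n
  κ m = con (pos m)

-- Finite fields

module _ (M : CommutativeMonoid 0ℓ 0ℓ) where
  open CommutativeMonoid M
  open import Algebra.Properties.CommutativeMonoid.Sum M
  open import Algebra.Properties.Monoid.Mult monoid using () renaming (_×_ to _·_)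
  open import Relation.Binary.Reasoning.Setoid setoid

  -- Reindexing by ρ multiplies every entry by a, so the total absorbs n · a.
  sum-absorbs-shift : ∀ {n} (e : Fin n → Carrier) (ρ : Permutation n n) a →
                      (∀ i → e (ρ ⟨$⟩ʳ i) ≈ a ∙ e i) → (n · a) ∙ sum e ≈ sum e
  sum-absorbs-shift {n} e ρ a shift = begin
    (n · a) ∙ sum e              ≈⟨ ∙-congʳ (sum-replicate n) ⟨
    sum {n} (λ _ → a) ∙ sum e    ≈⟨ ∑-distrib-+ (λ _ → a) e ⟨
    sum (λ i → a ∙ e i)          ≈⟨ sum-cong-≋ (λ i → sym (shift i)) ⟩
    sum (e ∘ (ρ ⟨$⟩ʳ_))          ≈⟨ sum-permute e ρ ⟨
    sum e                        ∎

odd⇒suc-double : ∀ {k} → 2 ∤ℕ k → ∃[ r ] k ≡ suc (r ℕ.+ r)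
odd⇒suc-double {zero}        2∤k = contradiction (dividesℕ 0 ≡.refl) 2∤k
odd⇒suc-double {suc zero}    2∤k = 0 , ≡.refl
odd⇒suc-double {suc (suc k)} 2∤k
  with r , eq ← odd⇒suc-double {k} (λ { (dividesℕ c k≡) → 2∤k (dividesℕ (suc c) (≡.cong (ℕ._+_ 2) k≡)) })
  = suc r , ≡.trans (≡.cong (ℕ._+_ 2) eq) (≡.cong (ℕ._+_ 2) (≡.sym (ℕₚ.+-suc r r)))

module FieldProperties (K : Field) where
  open Field K hiding (zero)
  open IntegerCoefficientSolver commutativeRing
  open import Algebra.Properties.Ring ring
  open import Algebra.Properties.Group +-group using (identityˡ-unique) renaming (x∙y⁻¹≈ε⇒x≈y to x-y≈0⇒x≈y)
  open import Algebra.Properties.CommutativeSemiring.Exp commutativeSemiring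
  open import Algebra.Properties.CommutativeMonoid.Sum *-commutativeMonoid using () renaming (sum to product)
  open import Algebra.Properties.Monoid.Mult +-monoid using (×-homo-+) renaming (_×_ to _·_)
  open import Relation.Binary.Reasoning.Setoid setoid

  inverseˡ : ∀ {x} → x ≉ 0# → x ⁻¹ * x ≈ 1#
  inverseˡ x≉0 = trans (*-comm _ _) (inverseʳ x≉0)

  *-cancelˡ-nonZero : ∀ {z x y} → z ≉ 0# → z * x ≈ z * y → x ≈ y
  *-cancelˡ-nonZero {z} {x} {y} z≉0 zx≈zy = begin
    x                ≈⟨ unscale x ⟨
    z ⁻¹ * (z * x)   ≈⟨ *-congˡ zx≈zy ⟩
    z ⁻¹ * (z * y)   ≈⟨ unscale y ⟩
    y                ∎
    where
    unscale : ∀ t → z ⁻¹ * (z * t) ≈ t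
    unscale t = trans (sym (*-assoc _ _ _)) (trans (*-congʳ (inverseˡ z≉0)) (*-identityˡ t))

  zero-product : ∀ {x y} → x ≉ 0# → x * y ≈ 0# → y ≈ 0#
  zero-product x≉0 xy≈0 = *-cancelˡ-nonZero x≉0 (trans xy≈0 (sym (zeroʳ _)))

  *-nonZero : ∀ {x y} → x ≉ 0# → y ≉ 0# → x * y ≉ 0#
  *-nonZero x≉0 y≉0 xy≈0 = y≉0 (zero-product x≉0 xy≈0)

  ^-nonZero : ∀ {x} n → x ≉ 0# → x ^ n ≉ 0#
  ^-nonZero zero    x≉0 1≈0 = 0≉1 (sym 1≈0)
  ^-nonZero (suc n) x≉0     = *-nonZero x≉0 (^-nonZero n x≉0)

  inverse-unique : ∀ {x y} → x * y ≈ 1# → y ≈ x ⁻¹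
  inverse-unique {x} {y} xy≈1 = *-cancelˡ-nonZero x≉0 (trans xy≈1 (sym (inverseʳ x≉0)))
    where
    x≉0 : x ≉ 0#
    x≉0 x≈0 = 0≉1 (trans (sym (zeroˡ y)) (trans (*-congʳ (sym x≈0)) xy≈1))

  product-nonZero : ∀ {n} (e : Fin n → Carrier) → (∀ i → e i ≉ 0#) → product e ≉ 0#
  product-nonZero {zero}  e e≉0 1≈0 = 0≉1 (sym 1≈0)
  product-nonZero {suc n} e e≉0     = *-nonZero (e≉0 Fin.zero) (product-nonZero (e ∘ Fin.suc) (e≉0 ∘ Fin.suc))

  square≈1 : ∀ {x} → x * x ≈ 1# → x ≈ 1# ⊎ x ≈ - 1#
  square≈1 {x} x²≈1 with x ≟ 1#
  ... | yes x≈1 = inj₁ x≈1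
  ... | no  x≉1 = inj₂ (x-y≈0⇒x≈y _ _ (zero-product (x≉1 ∘ x-y≈0⇒x≈y _ _) (begin
    (x - 1#) * (x - - 1#)   ≈⟨ solve 1 (λ x → (x :- κ 1) :* (x :- :- κ 1) := x :* x :- κ 1) refl x ⟩
    x * x - 1#              ≈⟨ +-congʳ x²≈1 ⟩
    1# - 1#                 ≈⟨ -‿inverseʳ 1# ⟩
    0#                      ∎)))

  1^n≈1 : ∀ n → 1# ^ n ≈ 1#
  1^n≈1 zero    = refl
  1^n≈1 (suc n) = trans (*-identityˡ _) (1^n≈1 n)

  ^-suc-double : ∀ x r → x ^ suc (r ℕ.+ r) ≈ x * (x * x) ^ r
  ^-suc-double x r = *-congˡ (trans (^-homo-* x r r) (sym (^-distrib-* x x r)))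

  [-1]^odd : ∀ {k} → 2 ∤ℕ k → (- 1#) ^ k ≈ - 1#
  [-1]^odd 2∤k with r , ≡.refl ← odd⇒suc-double 2∤k = begin
    (- 1#) ^ suc (r ℕ.+ r)          ≈⟨ ^-suc-double _ r ⟩
    - 1# * (- 1# * - 1#) ^ r        ≈⟨ *-congˡ (^-congˡ r (solve 0 (:- κ 1 :* :- κ 1 := κ 1) refl)) ⟩
    - 1# * 1# ^ r                   ≈⟨ *-congˡ (1^n≈1 r) ⟩
    - 1# * 1#                       ≈⟨ *-identityʳ _ ⟩
    - 1#                            ∎

  1≉-1 : 2# ≉ 0# → 1# ≉ - 1#
  1≉-1 2≉0 1≈-1 = 2≉0 (trans (+-congˡ 1≈-1) (-‿inverseʳ 1#))

  -- Removing the factors 2 of the exponent one at a time produces square roots of 1, each of them 1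
  -- or -1, and the descent stops at the first -1. For odd k and 2 ≠ 0, the 2-adic valuation of the
  -- order of x is then a + 1.
  first-sign : ∀ k e {x} → x ^ (2 ℕ.^ e ℕ.* k) ≈ 1# → x ^ k ≈ 1# ⊎ ∃[ a ] (a ℕ.< e × x ^ (2 ℕ.^ a ℕ.* k) ≈ - 1#)
  first-sign k zero    {x} xᵏ≈1 = inj₁ (trans (^-congʳ x (≡.sym (ℕₚ.*-identityˡ k))) xᵏ≈1)
  first-sign k (suc e) {x} y²≈1 with square≈1 (begin
      x ^ (2 ℕ.^ e ℕ.* k) * x ^ (2 ℕ.^ e ℕ.* k)     ≈⟨ ^-homo-* x (2 ℕ.^ e ℕ.* k) (2 ℕ.^ e ℕ.* k) ⟨
      x ^ (2 ℕ.^ e ℕ.* k ℕ.+ 2 ℕ.^ e ℕ.* k)         ≡⟨ ≡.cong (x ^_) (double (2 ℕ.^ e) k) ⟩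
      x ^ (2 ℕ.^ suc e ℕ.* k)                       ≈⟨ y²≈1 ⟩
      1#                                            ∎)
    where
    double : ∀ y k → y ℕ.* k ℕ.+ y ℕ.* k ≡ 2 ℕ.* y ℕ.* k
    double = solve-∀
  ... | inj₂ y≈-1 = inj₂ (e , ℕₚ.n<1+n e , y≈-1)
  ... | inj₁ y≈1 with first-sign k e y≈1
  ...   | inj₁ xᵏ≈1             = inj₁ xᵏ≈1
  ...   | inj₂ (a , a<e , x≈-1) = inj₂ (a , ℕₚ.m<n⇒m<1+n a<e , x≈-1)

  module Finite {q} (finite : HasCardinality K q) where
    open Inverse finite using (to; from; to-cong; strictlyInverseˡ; strictlyInverseʳ)

    from-injective : ∀ {i j} → from i ≈ from j → i ≡ j
    from-injective {i} {j} eq = ≡.trans (≡.sym (strictlyInverseˡ i)) (≡.trans (to-cong eq) (strictlyInverseˡ j))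

    transport : (g h : Carrier → Carrier) → (∀ {x y} → x ≈ y → g x ≈ g y) → (∀ {x y} → x ≈ y → h x ≈ h y) →
                (∀ x → g (h x) ≈ x) → (∀ x → h (g x) ≈ x) → Permutation q q
    transport g h g-cong h-cong gh hg = permutation (λ i → to (g (from i))) (λ i → to (h (from i)))
      (λ i → ≡.trans (to-cong (trans (g-cong (strictlyInverseʳ _)) (gh _))) (strictlyInverseˡ i))
      (λ i → ≡.trans (to-cong (trans (h-cong (strictlyInverseʳ _)) (hg _))) (strictlyInverseˡ i))

    -- Translation by 1 permutes the field, so adding q · 1 does not change the sum of all elements.
    q·1≈0 : q · 1# ≈ 0#
    q·1≈0 = identityˡ-unique _ _ (sum-absorbs-shift +-commutativeMonoid from
      (transport (1# +_) (- 1# +_) +-congˡ +-congˡ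
        (solve 1 (λ x → κ 1 :+ (:- κ 1 :+ x) := x) refl)
        (solve 1 (λ x → :- κ 1 :+ (κ 1 :+ x) := x) refl))
      1# (λ i → strictlyInverseʳ _))

    2≉0 : 2 ∤ℕ q → 2# ≉ 0#
    2≉0 2∤q 2≈0 with r , ≡.refl ← odd⇒suc-double 2∤q = 0≉1 (begin
      0#                         ≈⟨ q·1≈0 ⟨
      1# + (r ℕ.+ r) · 1#        ≈⟨ +-congˡ (×-homo-+ 1# r r) ⟩
      1# + (r · 1# + r · 1#)     ≈⟨ solve 1 (λ x → κ 1 :+ (x :+ x) := κ 1 :+ κ 2 :* x) refl (r · 1#) ⟩
      1# + 2# * (r · 1#)         ≈⟨ +-congˡ (trans (*-congʳ 2≈0) (zeroˡ _)) ⟩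
      1# + 0#                    ≈⟨ +-identityʳ 1# ⟩
      1#                         ∎)

  -- Multiplication by a permutes the units, so their product absorbs aⁿ; being non-zero, it can be
  -- cancelled.
  fermat : ∀ {n} → HasCardinality K (suc n) → ∀ {a} → a ≉ 0# → a ^ n ≈ 1#
  fermat {n} finite {a} a≉0 =
    *-cancelˡ-nonZero (product-nonZero units units≉0) (begin
      product units * a ^ n     ≈⟨ *-comm _ _ ⟩
      a ^ n * product units     ≈⟨ sum-absorbs-shift *-commutativeMonoid units ρ a units-shift ⟩
      product units             ≈⟨ *-identityʳ _ ⟨
      product units * 1#        ∎)
    where
    open Inverse finite using (to; from; to-cong; strictlyInverseˡ; strictlyInverseʳ)
    open Finite finite using (transport)

    i₀ : Fin (suc n)
    i₀ = to 0#

    units : Fin n → Carrier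
    units j = from (punchIn i₀ j)

    units≉0 : ∀ j → units j ≉ 0#
    units≉0 j eq = punchInᵢ≢i i₀ j (≡.trans (≡.sym (strictlyInverseˡ _)) (to-cong eq))

    π : Permutation (suc n) (suc n)
    π = transport (a *_) (a ⁻¹ *_) *-congˡ *-congˡ
      (λ x → trans (sym (*-assoc _ _ _)) (trans (*-congʳ (inverseʳ a≉0)) (*-identityˡ x)))
      (λ x → trans (sym (*-assoc _ _ _)) (trans (*-congʳ (inverseˡ a≉0)) (*-identityˡ x)))

    π-fixes-i₀ : π ⟨$⟩ʳ i₀ ≡ i₀
    π-fixes-i₀ = to-cong (trans (*-congˡ (strictlyInverseʳ 0#)) (zeroʳ a))

    -- Multiplication by a fixes 0, so deleting the index of 0 leaves a permutation of the indices
    -- of the units.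
    ρ : Permutation n n
    ρ = remove i₀ π

    units-shift : ∀ j → units (ρ ⟨$⟩ʳ j) ≈ a * units j
    units-shift j = begin
      from (punchIn i₀ (ρ ⟨$⟩ʳ j))              ≡⟨ ≡.cong (λ i → from (punchIn i (ρ ⟨$⟩ʳ j))) π-fixes-i₀ ⟨
      from (punchIn (π ⟨$⟩ʳ i₀) (ρ ⟨$⟩ʳ j))     ≡⟨ ≡.cong from (punchIn-permute π i₀ j) ⟨
      from (to (a * units j))                   ≈⟨ strictlyInverseʳ _ ⟩
      a * units j                               ∎

  fermat′ : ∀ {n} → HasCardinality K (suc n) → ∀ a → a ^ suc n ≈ a
  fermat′ finite a with a ≟ 0#
  ... | yes a≈0 = trans (*-congʳ a≈0) (trans (zeroˡ _) (sym a≈0))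
  ... | no  a≉0 = trans (*-congˡ (fermat finite a≉0)) (*-identityʳ a)

  -- The value at x of a monic polynomial: constant term first, the leading 1 is implicit.
  monic : ∀ {n} → Vec Carrier n → Carrier → Carrier
  monic as x = Vec.foldr′ (λ a y → a + x * y) 1# as

  -- Synthetic division by x - r: the coefficients of the quotient are the intermediate values of
  -- the Horner scheme at r.
  divide : ∀ {n} → Vec Carrier (suc n) → Carrier → Vec Carrier n
  divide (a Vec.∷ Vec.[])         r = Vec.[]
  divide (a Vec.∷ as@(_ Vec.∷ _)) r = monic as r Vec.∷ divide as r

  monic-divide : ∀ {n} (as : Vec Carrier (suc n)) r x → monic as x ≈ (x - r) * monic (divide as r) x + monic as r
  monic-divide (a Vec.∷ Vec.[]) r x =
    solve 3 (λ a r x → a :+ x :* κ 1 := (x :- r) :* κ 1 :+ (a :+ r :* κ 1)) refl a r x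
  monic-divide (a Vec.∷ as@(_ Vec.∷ _)) r x = begin
    a + x * monic as x                                              ≈⟨ +-congˡ (*-congˡ (monic-divide as r x)) ⟩
    a + x * ((x - r) * monic (divide as r) x + monic as r)          ≈⟨ solve 5 (λ a r x y m →
      a :+ x :* ((x :- r) :* y :+ m) := (x :- r) :* (m :+ x :* y) :+ (a :+ r :* m)) refl a r x _ _ ⟩
    (x - r) * (monic as r + x * monic (divide as r) x) + (a + r * monic as r) ∎

  -- Dividing out the first root leaves the others as roots of a quotient of smaller degree, because
  -- differences of distinct roots are non-zero.
  few-roots : ∀ {n} (as : Vec Carrier n) (r : Fin (suc n) → Carrier) →
              (∀ {i j} → r i ≈ r j → i ≡ j) → ¬ (∀ i → monic as (r i) ≈ 0#)
  few-roots Vec.[]           r inj root = 0≉1 (sym (root Fin.zero))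
  few-roots as@(_ Vec.∷ _) r inj root = few-roots (divide as (r Fin.zero)) (r ∘ Fin.suc) (suc-inj ∘ inj) (λ i →
    zero-product (λ eq → 0≢suc (inj (x-y≈0⇒x≈y _ _ eq))) (begin
      (r (Fin.suc i) - r Fin.zero) * monic (divide as (r Fin.zero)) (r (Fin.suc i))                     ≈⟨ +-identityʳ _ ⟨
      (r (Fin.suc i) - r Fin.zero) * monic (divide as (r Fin.zero)) (r (Fin.suc i)) + 0#                ≈⟨ +-congˡ (root Fin.zero) ⟨
      (r (Fin.suc i) - r Fin.zero) * monic (divide as (r Fin.zero)) (r (Fin.suc i)) + monic as (r Fin.zero) ≈⟨ monic-divide as (r Fin.zero) (r (Fin.suc i)) ⟨
      monic as (r (Fin.suc i))                                                              ≈⟨ root (Fin.suc i) ⟩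
      0#                                                                                ∎))
    where
    suc-inj : ∀ {n} {i j : Fin n} → Fin.suc i ≡ Fin.suc j → i ≡ j
    suc-inj ≡.refl = ≡.refl
    0≢suc : ∀ {n} {i : Fin n} → Fin.suc i ≢ Fin.zero
    0≢suc ()

  -- The exponent has the form q + 2, so that x^(q+2) - x has the coefficients 0, -1, 0, ..., 0
  -- below its leading 1.
  few-solutions-of-x^q≈x : ∀ q (r : Fin (suc (suc (suc q))) → Carrier) →
                (∀ {i j} → r i ≈ r j → i ≡ j) → ¬ (∀ i → r i ^ suc (suc q) ≈ r i)
  few-solutions-of-x^q≈x q r inj root = few-roots (0# Vec.∷ - 1# Vec.∷ zeros q) r inj (λ i → begin
    0# + r i * (- 1# + r i * monic (zeros q) (r i))   ≈⟨ +-congˡ (*-congˡ (+-congˡ (*-congˡ (monic-zeros q (r i))))) ⟩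
    0# + r i * (- 1# + r i * r i ^ q)                 ≈⟨ solve 2 (λ x y → κ 0 :+ x :* (:- κ 1 :+ x :* y) := x :* (x :* y) :- x) refl _ _ ⟩
    r i ^ suc (suc q) - r i                           ≈⟨ +-congʳ (root i) ⟩
    r i - r i                                         ≈⟨ -‿inverseʳ _ ⟩
    0#                                                ∎)
    where
    zeros : ∀ n → Vec Carrier n
    zeros n = Vec.replicate n 0#
    monic-zeros : ∀ n x → monic (zeros n) x ≈ x ^ n
    monic-zeros zero    x = refl
    monic-zeros (suc n) x = trans (+-identityˡ _) (*-congˡ (monic-zeros n x))

-- The polynomial ring

module PolynomialRing (F : Field) where
  open Field F using (Carrier; _≈_; _+_; _*_; -_; _-_; 0#; 1#; 2#; _≟_; refl; sym; trans; +-cong; +-congˡ; +-congʳ; *-cong; *-congˡ; *-congʳ; +-identityˡ; +-identityʳ; *-identityˡ; *-identityʳ; zeroˡ; zeroʳ; +-assoc; +-comm; *-assoc; *-comm; distribˡ; distribʳ; -‿cong; -‿inverseʳ; -‿inverseˡ; setoid; 0≉1; _≉_)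
  open Polynomials F hiding (_∣_; sum; _^_; Irreducible)
  open IntegerCoefficientSolver (Field.commutativeRing F)
  import Relation.Binary.Reasoning.Setoid as SetoidReasoning
  private module FR = SetoidReasoning setoid

  -- A wrapper of _≈ₚ_ from which both polynomials can be inferred.
  infix 4 _≋_
  record _≋_ (f g : Poly) : Set where
    constructor coeffwise
    field at : f ≈ₚ g
  open _≋_ public

  scale : Carrier → Poly → Poly
  scale a = map (a *_)

  negate : Poly → Poly
  negate = map (λ a → - a)

  coeff-+ : ∀ f g i → coeff (f +ₚ g) i ≈ coeff f i + coeff g i
  coeff-+ []      g       i       = sym (+-identityˡ _)
  coeff-+ (a ∷ f) []      i       = sym (+-identityʳ _)
  coeff-+ (a ∷ f) (b ∷ g) zero    = refl
  coeff-+ (a ∷ f) (b ∷ g) (suc i) = coeff-+ f g i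

  coeff-scale : ∀ a f i → coeff (scale a f) i ≈ a * coeff f i
  coeff-scale a []      i       = sym (zeroʳ a)
  coeff-scale a (b ∷ f) zero    = refl
  coeff-scale a (b ∷ f) (suc i) = coeff-scale a f i

  coeff-negate : ∀ f i → coeff (negate f) i ≈ - coeff f i
  coeff-negate []      i       = solve 0 (κ 0 := :- κ 0) refl
  coeff-negate (b ∷ f) zero    = refl
  coeff-negate (b ∷ f) (suc i) = coeff-negate f i

  polySetoid : Setoid 0ℓ 0ℓ
  polySetoid = record
    { Carrier = Poly
    ; _≈_ = _≋_
    ; isEquivalence = record
      { refl  = coeffwise λ i → refl
      ; sym   = λ p → coeffwise λ i → sym (at p i)
      ; trans = λ p q → coeffwise λ i → trans (at p i) (at q i) }
    }

  private
    module S = Setoid polySetoid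
    module PR = SetoidReasoning polySetoid

  ∷-cong : ∀ {a b f g} → a ≈ b → f ≋ g → a ∷ f ≋ b ∷ g
  ∷-cong p q = coeffwise λ { zero → p ; (suc i) → at q i }

  +ₚ-cong : ∀ {f f′ g g′} → f ≋ f′ → g ≋ g′ → f +ₚ g ≋ f′ +ₚ g′
  +ₚ-cong {f} {f′} {g} {g′} p q = coeffwise λ i → trans (coeff-+ f g i) (trans (+-cong (at p i) (at q i)) (sym (coeff-+ f′ g′ i)))

  +ₚ-comm : ∀ f g → f +ₚ g ≋ g +ₚ f
  +ₚ-comm f g = coeffwise λ i → trans (coeff-+ f g i) (trans (+-comm _ _) (sym (coeff-+ g f i)))

  +ₚ-assoc : ∀ f g h → (f +ₚ g) +ₚ h ≋ f +ₚ (g +ₚ h)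
  +ₚ-assoc f g h = coeffwise λ i → FR.begin
    coeff ((f +ₚ g) +ₚ h) i             FR.≈⟨ trans (coeff-+ (f +ₚ g) h i) (+-congʳ (coeff-+ f g i)) ⟩
    coeff f i + coeff g i + coeff h i   FR.≈⟨ +-assoc _ _ _ ⟩
    coeff f i + (coeff g i + coeff h i) FR.≈⟨ sym (trans (coeff-+ f (g +ₚ h) i) (+-congˡ (coeff-+ g h i))) ⟩
    coeff (f +ₚ (g +ₚ h)) i             FR.∎

  +ₚ-identityʳ : ∀ f → f +ₚ [] ≋ f
  +ₚ-identityʳ f = +ₚ-comm f []

  negate-cong : ∀ {f g} → f ≋ g → negate f ≋ negate g
  negate-cong {f} {g} p = coeffwise λ i → trans (coeff-negate f i) (trans (-‿cong (at p i)) (sym (coeff-negate g i)))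

  negate-inverseˡ : ∀ f → negate f +ₚ f ≋ []
  negate-inverseˡ f = coeffwise λ i → trans (coeff-+ (negate f) f i) (trans (+-congʳ (coeff-negate f i)) (-‿inverseˡ _))

  +ₚ-commutativeMonoid : CommutativeMonoid 0ℓ 0ℓ
  +ₚ-commutativeMonoid = record
    { Carrier = Poly ; _≈_ = _≋_ ; _∙_ = _+ₚ_ ; ε = []
    ; isCommutativeMonoid = record
      { isMonoid = record
        { isSemigroup = record
          { isMagma = record { isEquivalence = S.isEquivalence ; ∙-cong = +ₚ-cong }
          ; assoc = +ₚ-assoc }
        ; identity = (λ _ → S.refl) , +ₚ-identityʳ }
      ; comm = +ₚ-comm } }

  private
    module + = CommutativeMonoid +ₚ-commutativeMonoid
  open import Algebra.Properties.CommutativeSemigroup +.commutativeSemigroup using (interchange; x∙yz≈y∙xz)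

  scale-cong : ∀ {a b f g} → a ≈ b → f ≋ g → scale a f ≋ scale b g
  scale-cong {a} {b} {f} {g} p q = coeffwise λ i → trans (coeff-scale a f i) (trans (*-cong p (at q i)) (sym (coeff-scale b g i)))

  scale-zero : ∀ f → scale 0# f ≋ []
  scale-zero f = coeffwise λ i → trans (coeff-scale 0# f i) (zeroˡ _)

  scale-one : ∀ f → scale 1# f ≋ f
  scale-one f = coeffwise λ i → trans (coeff-scale 1# f i) (*-identityˡ _)

  scale-distribˡ : ∀ a f g → scale a (f +ₚ g) ≋ scale a f +ₚ scale a g
  scale-distribˡ a f g = coeffwise λ i → FR.begin
    coeff (scale a (f +ₚ g)) i         FR.≈⟨ trans (coeff-scale a (f +ₚ g) i) (*-congˡ (coeff-+ f g i)) ⟩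
    a * (coeff f i + coeff g i)        FR.≈⟨ distribˡ _ _ _ ⟩
    a * coeff f i + a * coeff g i      FR.≈⟨ +-cong (coeff-scale a f i) (coeff-scale a g i) ⟨
    coeff (scale a f) i + coeff (scale a g) i FR.≈⟨ coeff-+ (scale a f) (scale a g) i ⟨
    coeff (scale a f +ₚ scale a g) i   FR.∎

  scale-scale : ∀ a b f → scale (a * b) f ≋ scale a (scale b f)
  scale-scale a b f = coeffwise λ i → FR.begin
    coeff (scale (a * b) f) i          FR.≈⟨ coeff-scale (a * b) f i ⟩
    a * b * coeff f i                  FR.≈⟨ *-assoc _ _ _ ⟩
    a * (b * coeff f i)                FR.≈⟨ *-congˡ (coeff-scale b f i) ⟨
    a * coeff (scale b f) i            FR.≈⟨ coeff-scale a (scale b f) i ⟨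
    coeff (scale a (scale b f)) i      FR.∎

  0∷-cong : ∀ {f g} → f ≋ g → 0# ∷ f ≋ 0# ∷ g
  0∷-cong = ∷-cong refl

  0∷[]≈[] : 0# ∷ [] ≋ []
  0∷[]≈[] = coeffwise λ { zero → refl ; (suc i) → refl }

  0∷-+ : ∀ f g → (0# ∷ f) +ₚ (0# ∷ g) ≋ 0# ∷ (f +ₚ g)
  0∷-+ f g = ∷-cong (+-identityˡ 0#) S.refl

  *ₚ-congˡ : ∀ f {g h} → g ≋ h → f *ₚ g ≋ f *ₚ h
  *ₚ-congˡ []      p = S.refl
  *ₚ-congˡ (a ∷ f) {g} {h} p = +ₚ-cong (scale-cong refl p) (0∷-cong (*ₚ-congˡ f p))

  *ₚ-zeroˡ : ∀ f g → f ≋ [] → f *ₚ g ≋ []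
  *ₚ-zeroˡ []      g p = S.refl
  *ₚ-zeroˡ (a ∷ f) g p = PR.begin
    scale a g +ₚ (0# ∷ f *ₚ g)   PR.≈⟨ +ₚ-cong (scale-cong (at p zero) S.refl) (0∷-cong (*ₚ-zeroˡ f g (coeffwise (at p ∘ suc)))) ⟩
    scale 0# g +ₚ (0# ∷ [])      PR.≈⟨ +ₚ-cong (scale-zero g) 0∷[]≈[] ⟩
    []                           PR.∎

  *ₚ-zeroʳ : ∀ f → f *ₚ [] ≋ []
  *ₚ-zeroʳ []      = S.refl
  *ₚ-zeroʳ (a ∷ f) = S.trans (0∷-cong (*ₚ-zeroʳ f)) 0∷[]≈[]

  -- The defining recursion of `*ₚ`, mirrored in the second factor; commutativity follows by
  -- induction.
  *ₚ-∷ : ∀ f a g → f *ₚ (a ∷ g) ≋ scale a f +ₚ (0# ∷ f *ₚ g)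
  *ₚ-∷ []      a g = S.sym 0∷[]≈[]
  *ₚ-∷ (b ∷ f) a g = ∷-cong (+-congʳ (*-comm b a)) (PR.begin
    scale b g +ₚ f *ₚ (a ∷ g)                    PR.≈⟨ +ₚ-cong S.refl (*ₚ-∷ f a g) ⟩
    scale b g +ₚ (scale a f +ₚ (0# ∷ f *ₚ g))    PR.≈⟨ x∙yz≈y∙xz (scale b g) (scale a f) _ ⟩
    scale a f +ₚ (scale b g +ₚ (0# ∷ f *ₚ g))    PR.∎)

  *ₚ-comm : ∀ f g → f *ₚ g ≋ g *ₚ f
  *ₚ-comm []      g = S.sym (*ₚ-zeroʳ g)
  *ₚ-comm (a ∷ f) g = S.trans (+ₚ-cong S.refl (0∷-cong (*ₚ-comm f g))) (S.sym (*ₚ-∷ g a f))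

  *ₚ-cong : ∀ {f f′ g g′} → f ≋ f′ → g ≋ g′ → f *ₚ g ≋ f′ *ₚ g′
  *ₚ-cong {f} {f′} {g} {g′} p q = PR.begin
    f *ₚ g      PR.≈⟨ *ₚ-congˡ f q ⟩
    f *ₚ g′     PR.≈⟨ *ₚ-comm f g′ ⟩
    g′ *ₚ f     PR.≈⟨ *ₚ-congˡ g′ p ⟩
    g′ *ₚ f′    PR.≈⟨ *ₚ-comm g′ f′ ⟩
    f′ *ₚ g′    PR.∎

  *ₚ-distribˡ : ∀ f g h → f *ₚ (g +ₚ h) ≋ f *ₚ g +ₚ f *ₚ h
  *ₚ-distribˡ []      g h = S.refl
  *ₚ-distribˡ (a ∷ f) g h = PR.begin
    scale a (g +ₚ h) +ₚ (0# ∷ f *ₚ (g +ₚ h))                           PR.≈⟨ +ₚ-cong (scale-distribˡ a g h) (0∷-cong (*ₚ-distribˡ f g h)) ⟩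
    (scale a g +ₚ scale a h) +ₚ (0# ∷ f *ₚ g +ₚ f *ₚ h)                PR.≈⟨ +ₚ-cong S.refl (0∷-+ (f *ₚ g) (f *ₚ h)) ⟨
    (scale a g +ₚ scale a h) +ₚ ((0# ∷ f *ₚ g) +ₚ (0# ∷ f *ₚ h))       PR.≈⟨ interchange (scale a g) (scale a h) (0# ∷ f *ₚ g) (0# ∷ f *ₚ h) ⟩
    (scale a g +ₚ (0# ∷ f *ₚ g)) +ₚ (scale a h +ₚ (0# ∷ f *ₚ h))       PR.∎

  *ₚ-distribʳ : ∀ f g h → (g +ₚ h) *ₚ f ≋ g *ₚ f +ₚ h *ₚ f
  *ₚ-distribʳ f g h = PR.begin
    (g +ₚ h) *ₚ f        PR.≈⟨ *ₚ-comm (g +ₚ h) f ⟩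
    f *ₚ (g +ₚ h)        PR.≈⟨ *ₚ-distribˡ f g h ⟩
    f *ₚ g +ₚ f *ₚ h     PR.≈⟨ +ₚ-cong (*ₚ-comm f g) (*ₚ-comm f h) ⟩
    g *ₚ f +ₚ h *ₚ f     PR.∎

  scale-* : ∀ a f g → scale a f *ₚ g ≋ scale a (f *ₚ g)
  scale-* a []      g = S.refl
  scale-* a (b ∷ f) g = PR.begin
    scale (a * b) g +ₚ (0# ∷ scale a f *ₚ g)          PR.≈⟨ +ₚ-cong (scale-scale a b g) (∷-cong (sym (zeroʳ a)) (scale-* a f g)) ⟩
    scale a (scale b g) +ₚ scale a (0# ∷ f *ₚ g)      PR.≈⟨ scale-distribˡ a (scale b g) (0# ∷ f *ₚ g) ⟨
    scale a (scale b g +ₚ (0# ∷ f *ₚ g))              PR.∎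

  0∷-* : ∀ f g → (0# ∷ f) *ₚ g ≋ 0# ∷ f *ₚ g
  0∷-* f g = +ₚ-cong (scale-zero g) S.refl

  *ₚ-assoc : ∀ f g h → (f *ₚ g) *ₚ h ≋ f *ₚ (g *ₚ h)
  *ₚ-assoc []      g h = S.refl
  *ₚ-assoc (a ∷ f) g h = PR.begin
    (scale a g +ₚ (0# ∷ f *ₚ g)) *ₚ h             PR.≈⟨ *ₚ-distribʳ h (scale a g) (0# ∷ f *ₚ g) ⟩
    scale a g *ₚ h +ₚ (0# ∷ f *ₚ g) *ₚ h          PR.≈⟨ +ₚ-cong (scale-* a g h) (S.trans (0∷-* (f *ₚ g) h) (0∷-cong (*ₚ-assoc f g h))) ⟩
    scale a (g *ₚ h) +ₚ (0# ∷ f *ₚ (g *ₚ h))      PR.∎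

  *ₚ-identityˡ : ∀ f → (1# ∷ []) *ₚ f ≋ f
  *ₚ-identityˡ f = S.trans (+ₚ-cong (scale-one f) 0∷[]≈[]) (+ₚ-identityʳ f)

  polynomialRing : CommutativeRing 0ℓ 0ℓ
  polynomialRing = record
    { Carrier = Poly ; _≈_ = _≋_ ; _+_ = _+ₚ_ ; _*_ = _*ₚ_ ; -_ = negate ; 0# = [] ; 1# = 1# ∷ []
    ; isCommutativeRing = record
      { isRing = record
        { +-isAbelianGroup = record
          { isGroup = record
            { isMonoid = +.isMonoid
            ; inverse = negate-inverseˡ , λ f → S.trans (+ₚ-comm f (negate f)) (negate-inverseˡ f)
            ; ⁻¹-cong = negate-cong }
          ; comm = +ₚ-comm }
        ; *-cong = *ₚ-cong
        ; *-assoc = *ₚ-assoc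
        ; *-identity = *ₚ-identityˡ , λ f → S.trans (*ₚ-comm f (1# ∷ [])) (*ₚ-identityˡ f)
        ; distrib = *ₚ-distribˡ , *ₚ-distribʳ }
      ; *-comm = *ₚ-comm } }

  constant-* : ∀ a f → (a ∷ []) *ₚ f ≋ scale a f
  constant-* a f = S.trans (+ₚ-cong S.refl 0∷[]≈[]) (+ₚ-identityʳ (scale a f))

  -- Bounds tolerate trailing zeros in the coefficient lists. Moreover `Degree< f 0` singles out the
  -- zero polynomial, which `degree` does not separate from the non-zero constants.
  Degree≤ Degree< MonicOfDegree : Poly → ℕ → Set
  Degree≤ f d = ∀ i → d < i → coeff f i ≈ 0#
  Degree< f d = ∀ i → d ≤ i → coeff f i ≈ 0#
  MonicOfDegree f d = coeff f d ≈ 1# × Degree≤ f d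

  All⇒≈[] : ∀ {f} → All (_≈ 0#) f → f ≋ []
  All⇒≈[] All.[]       = coeffwise λ _ → refl
  All⇒≈[] (p All.∷ ps) = coeffwise λ { zero → p ; (suc i) → at (All⇒≈[] ps) i }

  ≈[]⇒All : ∀ f → f ≋ [] → All (_≈ 0#) f
  ≈[]⇒All []      p = All.[]
  ≈[]⇒All (a ∷ f) p = at p zero All.∷ ≈[]⇒All f (coeffwise (at p ∘ suc))

  zero? : ∀ f → Dec (f ≋ [])
  zero? f = map′ All⇒≈[] (≈[]⇒All f) (all? (_≟ 0#) f)

  Degree≤-degree : ∀ f → Degree≤ f (degree f)
  Degree≤-degree []      i       _ = refl
  Degree≤-degree (a ∷ f) (suc i) lt with all? (_≟ 0#) f | lt
  ... | yes f≈0 | _       = at (All⇒≈[] f≈0) i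
  ... | no  _   | s≤s lt′ = Degree≤-degree f i lt′

  degree-unique : ∀ f d → coeff f d ≉ 0# → Degree≤ f d → degree f ≡ d
  degree-unique []      d       top≉0 deg = contradiction refl top≉0
  degree-unique (a ∷ f) zero    top≉0 deg with all? (_≟ 0#) f
  ... | yes _   = ≡.refl
  ... | no  f≉0 = contradiction (≈[]⇒All f (coeffwise λ i → deg (suc i) (s≤s z≤n))) f≉0
  degree-unique (a ∷ f) (suc d) top≉0 deg with all? (_≟ 0#) f
  ... | yes f≈0 = contradiction (at (All⇒≈[] f≈0) d) top≉0
  ... | no  _   = ≡.cong suc (degree-unique f d top≉0 (λ i lt → deg (suc i) (s≤s lt)))

  monic⇒MonicOfDegree : ∀ f → Monic f → MonicOfDegree f (degree f)
  monic⇒MonicOfDegree f m = m , Degree≤-degree f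

  MonicOfDegree⇒degree : ∀ f d → MonicOfDegree f d → degree f ≡ d
  MonicOfDegree⇒degree f d (m , deg) = degree-unique f d (λ top≈0 → 0≉1 (trans (sym top≈0) m)) deg

  MonicOfDegree⇒monic : ∀ f d → MonicOfDegree f d → Monic f
  MonicOfDegree⇒monic f d m = ≡.subst (λ e → coeff f e ≈ 1#) (≡.sym (MonicOfDegree⇒degree f d m)) (proj₁ m)

  MonicOfDegree-cong : ∀ f g {d} → f ≋ g → MonicOfDegree f d → MonicOfDegree g d
  MonicOfDegree-cong f g f≈g (m , deg) = trans (sym (at f≈g _)) m , λ i lt → trans (sym (at f≈g i)) (deg i lt)

  -- Top coefficients are multiplicative for whatever bounds are given, even if they vanish; both
  -- claims come from one induction because each reduces to the product with the tail of f.
  product-degree : ∀ f g {m n} → Degree≤ f m → Degree≤ g n →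
                   Degree≤ (f *ₚ g) (m ℕ.+ n) × coeff (f *ₚ g) (m ℕ.+ n) ≈ coeff f m * coeff g n
  product-degree []      g         degf degg = (λ _ _ → refl) , sym (zeroˡ _)
  product-degree (a ∷ f) g {zero} {n} degf degg =
    (λ i lt → trans (fg≈ag i) (trans (*-congˡ (degg i lt)) (zeroʳ a))) , fg≈ag n
    where
    fg≈ag : ∀ i → coeff ((a ∷ f) *ₚ g) i ≈ a * coeff g i
    fg≈ag i = FR.begin
      coeff (scale a g +ₚ (0# ∷ f *ₚ g)) i     FR.≈⟨ at (+ₚ-cong (S.refl {scale a g}) (S.trans (0∷-cong (*ₚ-zeroˡ f g (coeffwise λ j → degf (suc j) (s≤s z≤n)))) 0∷[]≈[])) i ⟩
      coeff (scale a g +ₚ []) i                FR.≈⟨ at (+ₚ-identityʳ (scale a g)) i ⟩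
      coeff (scale a g) i                      FR.≈⟨ coeff-scale a g i ⟩
      a * coeff g i                            FR.∎
  product-degree (a ∷ f) g {suc m} {n} degf degg =
    (λ { (suc i) (s≤s lt) → trans (shift i (ℕₚ.≤-trans (ℕₚ.m≤n+m n m) (ℕₚ.<⇒≤ lt))) (proj₁ tail i lt) })
    , trans (shift (m ℕ.+ n) (ℕₚ.m≤n+m n m)) (proj₂ tail)
    where
    tail = product-degree f g (λ i lt → degf (suc i) (s≤s lt)) degg
    shift : ∀ i → n ≤ i → coeff ((a ∷ f) *ₚ g) (suc i) ≈ coeff (f *ₚ g) i
    shift i n≤i = FR.begin
      coeff (scale a g +ₚ (0# ∷ f *ₚ g)) (suc i)    FR.≈⟨ coeff-+ (scale a g) (0# ∷ f *ₚ g) (suc i) ⟩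
      coeff (scale a g) (suc i) + coeff (f *ₚ g) i  FR.≈⟨ +-congʳ (trans (coeff-scale a g (suc i)) (trans (*-congˡ (degg (suc i) (s≤s n≤i))) (zeroʳ a))) ⟩
      0# + coeff (f *ₚ g) i                         FR.≈⟨ +-identityˡ _ ⟩
      coeff (f *ₚ g) i                              FR.∎

-- Residue fields

module QuotientRing (R : CommutativeRing 0ℓ 0ℓ) (f : CommutativeRing.Carrier R) where
  open CommutativeRing R
  open IntegerCoefficientSolver R using (solve; κ; _:+_; _:*_; _:-_; :-_; _:=_)

  infix 4 _≈f_
  record _≈f_ (a b : Carrier) : Set where
    constructor _mod-f
    field
      {multiple} : Carrier
      difference : a ≈ b + multiple * f

  ≈⇒≈f : ∀ {a b} → a ≈ b → a ≈f b
  ≈⇒≈f {a} {b} a≈b = _mod-f {multiple = 0#} (trans a≈b (solve 2 (λ b f → b := b :+ κ 0 :* f) refl b f))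

  quotientRing : CommutativeRing 0ℓ 0ℓ
  quotientRing = record
    { Carrier = Carrier ; _≈_ = _≈f_ ; _+_ = _+_ ; _*_ = _*_ ; -_ = -_ ; 0# = 0# ; 1# = 1#
    ; isCommutativeRing = record
      { isRing = record
        { +-isAbelianGroup = record
          { isGroup = record
            { isMonoid = record
              { isSemigroup = record
                { isMagma = record
                  { isEquivalence = record
                    { refl  = ≈⇒≈f refl
                    ; sym   = λ { {a} {b} (_mod-f {c} a≈b+cf) → _mod-f {multiple = - c} (trans
                        (solve 3 (λ b c f → b := b :+ c :* f :+ (:- c) :* f) refl b c f)
                        (+-congʳ (sym a≈b+cf))) }
                    ; trans = λ { {a} {b} {e} (_mod-f {c} a≈b+cf) (_mod-f {c′} b≈e+c′f) → _mod-f {multiple = c′ + c} (trans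
                        (trans a≈b+cf (+-congʳ b≈e+c′f))
                        (solve 4 (λ e c c′ f → e :+ c′ :* f :+ c :* f := e :+ (c′ :+ c) :* f) refl e c c′ f)) } }
                  ; ∙-cong = λ { {a} {b} {a′} {b′} (_mod-f {c} p) (_mod-f {c′} p′) → _mod-f {multiple = c + c′} (trans (+-cong p p′)
                      (solve 5 (λ b b′ c c′ f → b :+ c :* f :+ (b′ :+ c′ :* f) := b :+ b′ :+ (c :+ c′) :* f) refl b b′ c c′ f)) } }
                ; assoc = λ a b c → ≈⇒≈f (+-assoc a b c) }
              ; identity = (λ a → ≈⇒≈f (+-identityˡ a)) , (λ a → ≈⇒≈f (+-identityʳ a)) }
            ; inverse = (λ a → ≈⇒≈f (-‿inverseˡ a)) , (λ a → ≈⇒≈f (-‿inverseʳ a))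
            ; ⁻¹-cong = λ { {a} {b} (_mod-f {c} p) → _mod-f {multiple = - c} (trans (-‿cong p)
                (solve 3 (λ b c f → :- (b :+ c :* f) := :- b :+ :- c :* f) refl b c f)) } }
          ; comm = λ a b → ≈⇒≈f (+-comm a b) }
        ; *-cong = λ { {a} {b} {a′} {b′} (_mod-f {c} p) (_mod-f {c′} p′) → _mod-f {multiple = b * c′ + c * b′ + c * c′ * f} (trans (*-cong p p′)
            (solve 5 (λ b b′ c c′ f → (b :+ c :* f) :* (b′ :+ c′ :* f) := b :* b′ :+ (b :* c′ :+ c :* b′ :+ c :* c′ :* f) :* f) refl b b′ c c′ f)) }
        ; *-assoc = λ a b c → ≈⇒≈f (*-assoc a b c)
        ; *-identity = (λ a → ≈⇒≈f (*-identityˡ a)) , (λ a → ≈⇒≈f (*-identityʳ a))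
        ; distrib = (λ a b c → ≈⇒≈f (distribˡ a b c)) , (λ a b c → ≈⇒≈f (distribʳ a b c)) }
      ; *-comm = λ a b → ≈⇒≈f (*-comm a b) } }

-- Over an abstract ring the operations do not unfold; the identities are then instantiated at the
-- polynomial ring, where multiplication computes on lists.
module RingIdentities (R : CommutativeRing 0ℓ 0ℓ) where
  open CommutativeRing R
  open IntegerCoefficientSolver R using (solve; κ; _:+_; _:*_; _:-_; :-_; _:=_)
  open import Relation.Binary.Reasoning.Setoid setoid

  y+z≈[x+y]+[z-x] : ∀ x y z → y + z ≈ (x + y) + (z - x)
  y+z≈[x+y]+[z-x] = solve 3 (λ x y z → y :+ z := (x :+ y) :+ (z :- x)) refl

  x+y-x≈y : ∀ x y → x + y - x ≈ y
  x+y-x≈y = solve 2 (λ x y → x :+ y :- x := y) refl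

  x[yz]≈z[yx] : ∀ x y z → x * (y * z) ≈ z * (y * x)
  x[yz]≈z[yx] = solve 3 (λ x y z → x :* (y :* z) := z :* (y :* x)) refl

  x[yz]≈yx*z : ∀ x y z → x * (y * z) ≈ y * x * z
  x[yz]≈yx*z = solve 3 (λ x y z → x :* (y :* z) := y :* x :* z) refl

  [x-1]y≈xy-y : ∀ x y → (x - 1#) * y ≈ x * y - y
  [x-1]y≈xy-y = solve 2 (λ x y → (x :- κ 1) :* y := x :* y :- y) refl

  -- Modulo f the division reads r ≡ -qca, so an inverse b of r yields the inverse -cqb of a.
  euclid-step : ∀ {a b c e f q r} → f ≈ q * (c * a) + r → r * b ≈ 1# + e * f →
                a * - (c * q * b) ≈ 1# + (e - b) * f
  euclid-step {a} {b} {c} {e} {f} {q} {r} f≈ rb≈ = begin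
    a * - (c * q * b)                     ≈⟨ solve 5 (λ a b c q r → a :* :- (c :* q :* b) := r :* b :- (q :* (c :* a) :+ r) :* b) refl a b c q r ⟩
    r * b - (q * (c * a) + r) * b         ≈⟨ +-cong rb≈ (-‿cong (*-congʳ (sym f≈))) ⟩
    (1# + e * f) - f * b                  ≈⟨ solve 3 (λ e f b → (κ 1 :+ e :* f) :- f :* b := κ 1 :+ (e :- b) :* f) refl e f b ⟩
    1# + (e - b) * f                      ∎

module Euclid (F : Field) (f : Polynomials.Poly F) {d} (f-monic : PolynomialRing.MonicOfDegree F f d) where
  open Polynomials F hiding (sum; _^_; _∣_; Irreducible)
  open PolynomialRing F
  private
    module F = Field F
    module P = CommutativeRing polynomialRing
    module FR where open import Relation.Binary.Reasoning.Setoid F.setoid public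
    module PR where open import Relation.Binary.Reasoning.Setoid P.setoid public
  open F using (Carrier; _≈_; 0#; 1#)
  open RingIdentities polynomialRing

  record DivMod (h : Poly) : Set where
    field
      quotient remainder : Poly
      division           : h ≋ quotient *ₚ f +ₚ remainder
      remainder<         : Degree< remainder d

  divMod : ∀ h → DivMod h
  divMod [] = record { quotient = [] ; remainder = [] ; division = P.refl ; remainder< = λ _ _ → F.refl }
  divMod (a ∷ h) = record
    { quotient   = c ∷ q
    ; remainder  = (a ∷ r) +ₚ negate (scale c f)
    ; division   = PR.begin
        a ∷ h                                     PR.≈⟨ ∷-cong (F.sym (F.+-identityˡ a)) division ⟩
        (0# ∷ q *ₚ f) +ₚ (a ∷ r)                  PR.≈⟨ y+z≈[x+y]+[z-x] (scale c f) (0# ∷ q *ₚ f) (a ∷ r) ⟩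
        (c ∷ q) *ₚ f +ₚ ((a ∷ r) +ₚ negate (scale c f)) PR.∎
    ; remainder< = remainder<′ }
    where
    open DivMod (divMod h) renaming (quotient to q; remainder to r)
    -- `a ∷ r` has degree at most d and f is monic, so subtracting c f clears exactly the
    -- coefficient at d; c becomes the new lowest coefficient of the quotient.
    c = coeff (a ∷ r) d
    coeff-remainder : ∀ i → coeff ((a ∷ r) +ₚ negate (scale c f)) i ≈ coeff (a ∷ r) i F.- c F.* coeff f i
    coeff-remainder i = F.trans (coeff-+ (a ∷ r) (negate (scale c f)) i)
      (F.+-congˡ (F.trans (coeff-negate (scale c f) i) (F.-‿cong (coeff-scale c f i))))
    remainder<′ : Degree< ((a ∷ r) +ₚ negate (scale c f)) d
    remainder<′ i d≤i with ℕₚ.m≤n⇒m<n∨m≡n d≤i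
    ... | inj₂ ≡.refl = FR.begin
      coeff ((a ∷ r) +ₚ negate (scale c f)) i    FR.≈⟨ coeff-remainder i ⟩
      c F.- c F.* coeff f d                      FR.≈⟨ F.+-congˡ (F.-‿cong (F.trans (F.*-congˡ (proj₁ f-monic)) (F.*-identityʳ c))) ⟩
      c F.- c                                    FR.≈⟨ F.-‿inverseʳ c ⟩
      0#                                         FR.∎
    remainder<′ (suc i) _ | inj₁ (s≤s d≤i) = FR.begin
      coeff ((a ∷ r) +ₚ negate (scale c f)) (suc i) FR.≈⟨ coeff-remainder (suc i) ⟩
      coeff r i F.- c F.* coeff f (suc i)        FR.≈⟨ F.+-cong (remainder< i d≤i) (F.-‿cong (F.trans (F.*-congˡ (proj₂ f-monic (suc i) (s≤s d≤i))) (F.zeroʳ c))) ⟩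
      0# F.- 0#                                  FR.≈⟨ F.-‿inverseʳ 0# ⟩
      0#                                         FR.∎

  -- The tail comes before the head: above degree d the summand b f vanishes, so the bound passes to
  -- the product of the tail with f. Once the tail is zero, b is the coefficient of b f at d.
  multiple-small⇒zero : ∀ q → Degree< (q *ₚ f) d → q ≋ []
  multiple-small⇒zero []      _     = P.refl
  multiple-small⇒zero (b ∷ q) small = P.trans (∷-cong b≈0 q≈[]) 0∷[]≈[]
    where
    q≈[] : q ≋ []
    q≈[] = multiple-small⇒zero q (λ i d≤i → FR.begin
      coeff (q *ₚ f) i                                  FR.≈⟨ F.+-identityˡ _ ⟨
      0# F.+ coeff (q *ₚ f) i                           FR.≈⟨ F.+-congʳ (F.trans (coeff-scale b f (suc i)) (F.trans (F.*-congˡ (proj₂ f-monic (suc i) (s≤s d≤i))) (F.zeroʳ b))) ⟨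
      coeff (scale b f) (suc i) F.+ coeff (q *ₚ f) i    FR.≈⟨ coeff-+ (scale b f) (0# ∷ q *ₚ f) (suc i) ⟨
      coeff ((b ∷ q) *ₚ f) (suc i)                      FR.≈⟨ small (suc i) (ℕₚ.m≤n⇒m≤1+n d≤i) ⟩
      0#                                                FR.∎)
    b≈0 : b ≈ 0#
    b≈0 = FR.begin
      b                                                 FR.≈⟨ F.*-identityʳ b ⟨
      b F.* 1#                                          FR.≈⟨ F.*-congˡ (proj₁ f-monic) ⟨
      b F.* coeff f d                                   FR.≈⟨ coeff-scale b f d ⟨
      coeff (scale b f) d                               FR.≈⟨ at (P.trans (P.+-cong (P.refl {scale b f}) (P.trans (0∷-cong (*ₚ-zeroˡ q f q≈[])) 0∷[]≈[])) (P.+-identityʳ (scale b f))) d ⟨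
      coeff ((b ∷ q) *ₚ f) d                            FR.≈⟨ small d ℕₚ.≤-refl ⟩
      0#                                                FR.∎

module QuotientField (F : Field) {p} (finite : HasCardinality F p)
                     (f : Polynomials.Poly F) {d} (f-monic : PolynomialRing.MonicOfDegree F f d)
                     (f-irreducible : Polynomials.Irreducible F f) where
  open Polynomials F hiding (sum; _^_)
  open PolynomialRing F
  open QuotientRing polynomialRing f
  private
    module F = Field F
    module P = CommutativeRing polynomialRing
    module Q = CommutativeRing quotientRing
    module FR where open import Relation.Binary.Reasoning.Setoid F.setoid public
    module PR where open import Relation.Binary.Reasoning.Setoid P.setoid public
  open F using (Carrier; _≈_; 0#; 1#)
  open Euclid F f f-monic
  open RingIdentities polynomialRing

  Degree<-≋ : ∀ {g h n} → g ≋ h → Degree< g n → Degree< h n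
  Degree<-≋ g≈h g< i n≤i = F.trans (F.sym (at g≈h i)) (g< i n≤i)

  -- Their difference is a multiple of f of degree below d. Remainders are therefore canonical
  -- representatives, which makes equality of classes decidable and the classes countable.
  small-congruent⇒≋ : ∀ g h → Degree< g d → Degree< h d → g ≈f h → g ≋ h
  small-congruent⇒≋ g h g< h< (_mod-f {c} g≈h+cf) = PR.begin
    g                    PR.≈⟨ g≈h+cf ⟩
    h +ₚ c *ₚ f          PR.≈⟨ P.+-congˡ (*ₚ-zeroˡ c f c≈[]) ⟩
    h +ₚ []              PR.≈⟨ P.+-identityʳ h ⟩
    h                    PR.∎
    where
    c≈[] : c ≋ []
    c≈[] = multiple-small⇒zero c (Degree<-≋
      (P.trans (P.+-congʳ g≈h+cf) (x+y-x≈y h (c *ₚ f)))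
      (λ i d≤i → F.trans (coeff-+ g (negate h) i) (F.trans
        (F.+-cong (g< i d≤i) (F.trans (coeff-negate h i) (F.-‿cong (h< i d≤i)))) (F.-‿inverseʳ 0#))))

  rem : Poly → Poly
  rem = DivMod.remainder ∘ divMod

  rem< : ∀ h → Degree< (rem h) d
  rem< = DivMod.remainder< ∘ divMod

  rem-congruent : ∀ h → h ≈f rem h
  rem-congruent h = _mod-f {multiple = quotient} (P.trans division (P.+-comm (quotient *ₚ f) remainder))
    where open DivMod (divMod h)

  rem-cong : ∀ {g h} → g ≈f h → rem g ≋ rem h
  rem-cong {g} {h} g≈h = small-congruent⇒≋ (rem g) (rem h) (rem< g) (rem< h)
    (Q.trans (Q.sym (rem-congruent g)) (Q.trans g≈h (rem-congruent h)))

  zeroᶠ? : ∀ g → Dec (g ≈f [])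
  zeroᶠ? g = map′ (λ r≈0 → Q.trans (rem-congruent g) (≈⇒≈f r≈0))
    (λ g≈0 → small-congruent⇒≋ (rem g) [] (rem< g) (λ _ _ → F.refl) (Q.trans (Q.sym (rem-congruent g)) g≈0)) (zero? (rem g))

  _≟ᶠ_ : Decidable _≈f_
  g ≟ᶠ h = map′ (x∙y⁻¹≈ε⇒x≈y g h) x≈y⇒x∙y⁻¹≈ε (zeroᶠ? (g +ₚ negate h))
    where open import Algebra.Properties.Group Q.+-group using (x∙y⁻¹≈ε⇒x≈y; x≈y⇒x∙y⁻¹≈ε)

  private
    X : Poly
    X = 0# ∷ 1# ∷ []

    C : Carrier → Poly
    C a = a ∷ []

  ∣⇒≈0 : ∀ {g} → f ∣ g → g ≈f []
  ∣⇒≈0 record { quotient = c ; equality = cf≈g } = _mod-f {multiple = c} (P.sym (coeffwise cf≈g))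

  ≈0⇒∣ : ∀ {g} → g ≈f [] → f ∣ g
  ≈0⇒∣ (_mod-f {c} g≈cf) = record { quotient = c ; equality = at (P.sym g≈cf) }

  1≉0 : ¬ (1# ∷ []) ≈f []
  1≉0 = Irreducible.p∤1 f-irreducible ∘ ≈0⇒∣

  -- The Euclidean algorithm: the remainder of f by a is again invertible modulo f.
  inverse-small : ∀ n → n ≤ d → ∀ a → Degree< a n → ¬ a ≋ [] → ∃[ b ] a *ₚ b ≈f C 1#
  inverse-small zero    _   a a< a≉0 = contradiction (coeffwise λ i → a< i z≤n) a≉0
  inverse-small (suc n) n<d a a< a≉0 with coeff a n F.≟ 0#
  ... | yes top≈0 = inverse-small n (ℕₚ.<⇒≤ n<d) a a<′ a≉0
    where
    a<′ : Degree< a n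
    a<′ i n≤i with ℕₚ.m≤n⇒m<n∨m≡n n≤i
    ... | inj₁ n<i    = a< i n<i
    ... | inj₂ ≡.refl = top≈0
  ... | no  top≉0 = go
    where
    c⁻¹ = coeff a n F.⁻¹
    -- Division with remainder is available for monic divisors, hence the normalisation.
    a′ = C c⁻¹ *ₚ a
    a′-coeff : ∀ i → coeff a′ i ≈ c⁻¹ F.* coeff a i
    a′-coeff i = F.trans (at (constant-* c⁻¹ a) i) (coeff-scale c⁻¹ a i)
    a′-monic : MonicOfDegree a′ n
    a′-monic = F.trans (a′-coeff n) (FieldProperties.inverseˡ F top≉0)
             , λ i n<i → F.trans (a′-coeff i) (F.trans (F.*-congˡ (a< i n<i)) (F.zeroʳ c⁻¹))
    a′≉0 : ¬ a′ ≋ []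
    a′≉0 a′≈0 = F.0≉1 (F.trans (F.sym (at a′≈0 n)) (proj₁ a′-monic))
    module E = Euclid F a′ a′-monic
    open E.DivMod (E.divMod f) renaming (quotient to q; remainder to r)

    go : ∃[ b ] a *ₚ b ≈f C 1#
    go with zero? r
    ... | no r≉0 with b , _mod-f {e} rb≈1 ← inverse-small n (ℕₚ.<⇒≤ n<d) r remainder< r≉0 =
      negate (C c⁻¹ *ₚ q *ₚ b) , _mod-f {multiple = e +ₚ negate b} (euclid-step {a} {b} {C c⁻¹} {e} {f} {q} {r} division rb≈1)
    -- Here f = q a′, so irreducibility makes q or a′ a unit. A unit a′ makes a invertible outright;
    -- a unit q would make a′ a multiple of f of degree n < d, hence zero.
    ... | yes r≈0 = by-factor (Irreducible.split-∣1 f-irreducible (at f≈qa′))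
      where
      f≈qa′ : f ≋ q *ₚ a′
      f≈qa′ = P.trans division (P.trans (P.+-congˡ {q *ₚ a′} r≈0) (P.+-identityʳ (q *ₚ a′)))

      by-factor : q ∣ C 1# ⊎ a′ ∣ C 1# → ∃[ b ] a *ₚ b ≈f C 1#
      by-factor (inj₂ record { quotient = s ; equality = sa′≈1 }) =
        C c⁻¹ *ₚ s , ≈⇒≈f (P.trans (x[yz]≈z[yx] a (C c⁻¹) s) (coeffwise sa′≈1))
      by-factor (inj₁ record { quotient = s ; equality = sq≈1 }) =
        contradiction (P.trans a′≈sf (*ₚ-zeroˡ s f s≈0)) a′≉0
        where
        sq≋1 : s *ₚ q ≋ C 1#
        sq≋1 = coeffwise sq≈1
        a′≈sf : a′ ≋ s *ₚ f
        a′≈sf = PR.begin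
          a′                          PR.≈⟨ P.*-identityˡ a′ ⟨
          C 1# *ₚ a′                  PR.≈⟨ P.*-congʳ {a′} sq≋1 ⟨
          s *ₚ q *ₚ a′                PR.≈⟨ P.*-assoc s q a′ ⟩
          s *ₚ (q *ₚ a′)              PR.≈⟨ P.*-congˡ {s} f≈qa′ ⟨
          s *ₚ f                      PR.∎
        s≈0 : s ≋ []
        s≈0 = multiple-small⇒zero s (Degree<-≋ a′≈sf (λ i d≤i → proj₂ a′-monic i (ℕₚ.≤-trans n<d d≤i)))

  inverse : ∀ a → ¬ a ≈f [] → ∃[ b ] a *ₚ b ≈f C 1#
  inverse a a≉0 with b , rb≈1 ← inverse-small d ℕₚ.≤-refl (rem a) (rem< a) (λ r≈0 → a≉0 (Q.trans (rem-congruent a) (≈⇒≈f r≈0))) =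
    b , Q.trans (Q.*-congʳ (rem-congruent a)) rb≈1

  private
    -- The decision is a separate argument, so that the congruence proof can compare the decisions
    -- made for two representatives of one class. The class of 0 gets the default value 0.
    recipᵈ : ∀ a → Dec (a ≈f []) → Poly
    recipᵈ a (yes _)   = []
    recipᵈ a (no a≉0)  = proj₁ (inverse a a≉0)

    recipᵈ-inverseʳ : ∀ a a≈0? → ¬ a ≈f [] → a *ₚ recipᵈ a a≈0? ≈f C 1#
    recipᵈ-inverseʳ a (yes a≈0) a≉0 = contradiction a≈0 a≉0
    recipᵈ-inverseʳ a (no a≉0)  _   = proj₂ (inverse a a≉0)

    recipᵈ-cong : ∀ a b a≈0? b≈0? → a ≈f b → recipᵈ a a≈0? ≈f recipᵈ b b≈0?
    recipᵈ-cong a b (yes a≈0) (yes b≈0) a≈b = Q.refl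
    recipᵈ-cong a b (yes a≈0) (no b≉0)  a≈b = contradiction (Q.trans (Q.sym a≈b) a≈0) b≉0
    recipᵈ-cong a b (no a≉0)  (yes b≈0) a≈b = contradiction (Q.trans a≈b b≈0) a≉0
    recipᵈ-cong a b (no a≉0)  (no b≉0)  a≈b = inverse-cong (proj₂ (inverse a a≉0)) (proj₂ (inverse b b≉0))
      where
      module QR where open import Relation.Binary.Reasoning.Setoid Q.setoid public
      inverse-cong : ∀ {x y} → a *ₚ x ≈f C 1# → b *ₚ y ≈f C 1# → x ≈f y
      inverse-cong {x} {y} ax≈1 by≈1 = QR.begin
        x                QR.≈⟨ Q.*-identityʳ x ⟨
        x *ₚ C 1#        QR.≈⟨ Q.*-congˡ {x} by≈1 ⟨
        x *ₚ (b *ₚ y)    QR.≈⟨ ≈⇒≈f (x[yz]≈yx*z x b y) ⟩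
        b *ₚ x *ₚ y      QR.≈⟨ Q.*-congʳ {y} (Q.*-congʳ {x} a≈b) ⟨
        a *ₚ x *ₚ y      QR.≈⟨ Q.*-congʳ {y} ax≈1 ⟩
        C 1# *ₚ y        QR.≈⟨ Q.*-identityˡ y ⟩
        y                QR.∎

  quotientField : Field
  quotientField = record
    { commutativeRing = quotientRing
    ; _≟_             = _≟ᶠ_
    ; 0≉1             = 1≉0 ∘ Q.sym
    ; _⁻¹             = λ a → recipᵈ a (zeroᶠ? a)
    ; ⁻¹-cong         = λ {a} {b} → recipᵈ-cong a b (zeroᶠ? a) (zeroᶠ? b)
    ; inverseʳ        = λ {a} → recipᵈ-inverseʳ a (zeroᶠ? a)
    }

  private module Fp = Inverse finite

  fromDigits : (Fin d → Fin p) → Poly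
  fromDigits v = tabulate (Fp.from ∘ v)

  coeff-tabulate : ∀ {n} (v : Fin n → Carrier) i → coeff (tabulate v) (toℕ i) ≡ v i
  coeff-tabulate v Fin.zero    = ≡.refl
  coeff-tabulate v (Fin.suc i) = coeff-tabulate (v ∘ Fin.suc) i

  Degree<-tabulate : ∀ {n} (v : Fin n → Carrier) → Degree< (tabulate v) n
  Degree<-tabulate {zero}  v i       _         = F.refl
  Degree<-tabulate {suc n} v (suc i) (s≤s n≤i) = Degree<-tabulate (v ∘ Fin.suc) i n≤i

  digits : Poly → Fin d → Fin p
  digits h i = Fp.to (coeff (rem h) (toℕ i))

  funToFin-cong : ∀ {m n} {v w : Fin m → Fin n} → (∀ i → v i ≡ w i) → funToFin v ≡ funToFin w
  funToFin-cong {zero}  eq = ≡.refl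
  funToFin-cong {suc m} eq = ≡.cong₂ combine (eq Fin.zero) (funToFin-cong (eq ∘ Fin.suc))

  digits-fromDigits : ∀ v i → digits (fromDigits v) i ≡ v i
  digits-fromDigits v i = ≡.trans (Fp.to-cong (F.trans
      (at (small-congruent⇒≋ (rem (fromDigits v)) (fromDigits v) (rem< (fromDigits v)) (Degree<-tabulate _) (Q.sym (rem-congruent (fromDigits v)))) (toℕ i))
      (F.reflexive (coeff-tabulate _ i))))
    (Fp.strictlyInverseˡ (v i))

  fromDigits-digits : ∀ h → fromDigits (digits h) ≈f h
  fromDigits-digits h = Q.trans (≈⇒≈f (coeffwise pointwise)) (Q.sym (rem-congruent h))
    where
    pointwise : ∀ i → coeff (fromDigits (digits h)) i ≈ coeff (rem h) i
    pointwise i with i ℕₚ.<? d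
    ... | no  i≮d = F.trans (Degree<-tabulate _ i (ℕₚ.≮⇒≥ i≮d)) (F.sym (rem< h i (ℕₚ.≮⇒≥ i≮d)))
    ... | yes i<d = ≡.subst (λ j → coeff (fromDigits (digits h)) j ≈ coeff (rem h) j) (toℕ-fromℕ< i<d)
      (F.trans (F.reflexive (coeff-tabulate _ (fromℕ< i<d))) (Fp.strictlyInverseʳ _))

  fromDigits-cong : ∀ {v w} → (∀ i → v i ≡ w i) → fromDigits v ≈f fromDigits w
  fromDigits-cong {v} {w} eq = ≈⇒≈f (coeffwise (≈tabulate (λ i → F.reflexive (≡.cong Fp.from (eq i)))))
    where
    ≈tabulate : ∀ {n} {v w : Fin n → Carrier} → (∀ i → v i ≈ w i) → tabulate v ≈ₚ tabulate w
    ≈tabulate {zero}  eq i       = F.refl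
    ≈tabulate {suc n} eq zero    = eq Fin.zero
    ≈tabulate {suc n} eq (suc i) = ≈tabulate (eq ∘ Fin.suc) i

  -- A class is encoded by the d coefficients of its remainder, read as d digits in base p.
  cardinality : HasCardinality quotientField (p ℕ.^ d)
  cardinality = record
    { to        = funToFin ∘ digits
    ; from      = fromDigits ∘ finToFun
    ; to-cong   = λ g≈h → to-cong g≈h
    ; from-cong = λ { ≡.refl → Q.refl }
    ; inverse   = (λ { {k} h≈ → ≡.trans (to-cong h≈) (≡.trans (funToFin-cong (digits-fromDigits (finToFun k))) (funToFin-finToFin {d} k)) })
                , λ { {h} ≡.refl → Q.trans (fromDigits-cong (finToFun-funToFin (digits h))) (fromDigits-digits h) }
    }
    where
    to-cong : ∀ {g h} → g ≈f h → funToFin (digits g) ≡ funToFin (digits h)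
    to-cong g≈h = funToFin-cong {d} (λ i → Fp.to-cong (at (rem-cong g≈h) (toℕ i)))

  extension : FiniteExtension F
  extension = record
    { K                  = quotientField
    ; embed              = C
    ; isRingHomomorphism = record
      { isSemiringHomomorphism = record
        { isNearSemiringHomomorphism = record
          { +-isMonoidHomomorphism = record
            { isMagmaHomomorphism = record
              { isRelHomomorphism = record { cong = λ a≈b → ≈⇒≈f (∷-cong a≈b P.refl) }
              ; homo = λ _ _ → Q.refl }
            ; ε-homo = ≈⇒≈f 0∷[]≈[] }
          ; *-homo = λ a b → ≈⇒≈f (∷-cong (F.sym (F.+-identityʳ (a F.* b))) P.refl) }
        ; 1#-homo = Q.refl }
      ; -‿homo = λ _ → Q.refl }
    ; q                  = p ℕ.^ d
    ; cardinality        = cardinality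
    }

  -- Consequently the class of x is a root of exactly the multiples of f, and every class is the
  -- value of its own representative.
  eval-X : ∀ h → eval extension h X ≈f h
  eval-X []      = Q.refl
  eval-X (a ∷ h) = Q.trans (Q.+-congˡ {C a} (Q.*-congˡ {X} (eval-X h))) (≈⇒≈f (PR.begin
    C a +ₚ (scale 0# h +ₚ (0# ∷ C 1# *ₚ h))       PR.≈⟨ P.+-congˡ {C a} (P.trans (P.+-congʳ (scale-zero h)) (0∷-cong (P.*-identityˡ h))) ⟩
    C a +ₚ (0# ∷ h)                               PR.≈⟨ ∷-cong (F.+-identityʳ a) P.refl ⟩
    a ∷ h                                         PR.∎))

-- Evaluation and the operation f ^R

module _ (M : CommutativeMonoid 0ℓ 0ℓ) where
  open CommutativeMonoid M
  open import Algebra.Properties.CommutativeMonoid.Sum M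

  -- Among the terms of `f ^R` only the one with i = m survives at the point 0, and also in degree
  -- 2m.
  sum-only-last : ∀ m (t : Fin (suc m) → Carrier) → (∀ i → toℕ i < m → t i ≈ ε) → sum t ≈ t (Fin.fromℕ m)
  sum-only-last zero    t _    = identityʳ _
  sum-only-last (suc m) t rest = trans (∙-cong (rest Fin.zero (s≤s z≤n)) (sum-only-last m (t ∘ Fin.suc) (λ i lt → rest (Fin.suc i) (s≤s lt)))) (identityˡ _)

module Evaluation (F : Field) (E : FiniteExtension F) where
  open FiniteExtension E using (K; embed; isRingHomomorphism)
  open IsRingHomomorphism isRingHomomorphism
  open Polynomials F hiding (_∣_; sum; _^_; Irreducible; eval)
  open PolynomialRing F
  private
    module F = Field F
    module P = Polynomials F
    module PR = CommutativeRing polynomialRing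
  open Field K hiding (zero)
  open FieldProperties K using (1^n≈1)
  open IntegerCoefficientSolver commutativeRing using (solve; κ; _:+_; _:*_; _:-_; :-_; _:=_)
  open import Algebra.Properties.CommutativeSemiring.Exp commutativeSemiring
  open import Algebra.Properties.CommutativeMonoid.Sum +-commutativeMonoid using (sum; sum-cong-≋)
  open import Algebra.Properties.Semiring.Sum semiring using (*-distribˡ-sum)
  open import Relation.Binary.Reasoning.Setoid setoid

  eval : Poly → Carrier → Carrier
  eval = P.eval E

  module _ (β : Carrier) where

    eval-zero : ∀ f → f ≋ [] → eval f β ≈ 0#
    eval-zero []      _   = refl
    eval-zero (a ∷ f) f≈0 = begin
      embed a + β * eval f β    ≈⟨ +-cong (⟦⟧-cong (at f≈0 0)) (*-congˡ (eval-zero f (coeffwise (at f≈0 ∘ suc)))) ⟩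
      embed F.0# + β * 0#       ≈⟨ +-cong 0#-homo (zeroʳ β) ⟩
      0# + 0#                   ≈⟨ +-identityʳ 0# ⟩
      0#                        ∎

    eval-cong : ∀ {f g} → f ≋ g → eval f β ≈ eval g β
    eval-cong {[]}    {g}     f≈g = sym (eval-zero g (PR.sym f≈g))
    eval-cong {a ∷ f} {[]}    f≈g = eval-zero (a ∷ f) f≈g
    eval-cong {a ∷ f} {b ∷ g} f≈g = +-cong (⟦⟧-cong (at f≈g 0)) (*-congˡ (eval-cong {f} {g} (coeffwise (at f≈g ∘ suc))))

    eval-+ : ∀ f g → eval (f +ₚ g) β ≈ eval f β + eval g β
    eval-+ []      g       = sym (+-identityˡ _)
    eval-+ (a ∷ f) []      = sym (+-identityʳ _)
    eval-+ (a ∷ f) (b ∷ g) = begin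
      embed (a F.+ b) + β * eval (f +ₚ g) β                ≈⟨ +-cong (+-homo a b) (*-congˡ (eval-+ f g)) ⟩
      (embed a + embed b) + β * (eval f β + eval g β)      ≈⟨ solve 5 (λ a b f g x → (a :+ b) :+ x :* (f :+ g) := (a :+ x :* f) :+ (b :+ x :* g)) refl _ _ _ _ β ⟩
      (embed a + β * eval f β) + (embed b + β * eval g β)  ∎

    eval-scale : ∀ a f → eval (scale a f) β ≈ embed a * eval f β
    eval-scale a []      = sym (zeroʳ _)
    eval-scale a (b ∷ f) = begin
      embed (a F.* b) + β * eval (scale a f) β      ≈⟨ +-cong (*-homo a b) (*-congˡ (eval-scale a f)) ⟩
      embed a * embed b + β * (embed a * eval f β)  ≈⟨ solve 4 (λ a b f x → a :* b :+ x :* (a :* f) := a :* (b :+ x :* f)) refl _ _ _ β ⟩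
      embed a * (embed b + β * eval f β)            ∎

    eval-* : ∀ f g → eval (f *ₚ g) β ≈ eval f β * eval g β
    eval-* []      g = sym (zeroˡ _)
    eval-* (a ∷ f) g = begin
      eval (scale a g +ₚ (F.0# ∷ f *ₚ g)) β               ≈⟨ eval-+ (scale a g) (F.0# ∷ f *ₚ g) ⟩
      eval (scale a g) β + (embed F.0# + β * eval (f *ₚ g) β) ≈⟨ +-cong (eval-scale a g) (+-cong 0#-homo (*-congˡ (eval-* f g))) ⟩
      embed a * eval g β + (0# + β * (eval f β * eval g β)) ≈⟨ solve 4 (λ a f g x → a :* g :+ (κ 0 :+ x :* (f :* g)) := (a :+ x :* f) :* g) refl _ _ _ β ⟩
      (embed a + β * eval f β) * eval g β                 ∎

    eval-constant : ∀ a → eval (a ∷ []) β ≈ embed a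
    eval-constant a = trans (+-congˡ (zeroʳ β)) (+-identityʳ _)

    eval-^ : ∀ f n → eval (f P.^ n) β ≈ eval f β ^ n
    eval-^ f zero    = trans (eval-constant F.1#) 1#-homo
    eval-^ f (suc n) = trans (eval-* f (f P.^ n)) (*-congˡ (eval-^ f n))

    eval-sum : ∀ {n} (t : Fin n → Poly) → eval (P.sum t) β ≈ sum (λ i → eval (t i) β)
    eval-sum {zero}  t = refl
    eval-sum {suc n} t = trans (eval-+ (t Fin.zero) (P.sum (t ∘ Fin.suc))) (+-congˡ (eval-sum (t ∘ Fin.suc)))

    -- Turns the Horner form of `eval` into the shape of the sum that defines `f ^R`.
    eval-as-sum : ∀ f n → Degree< f n → eval f β ≈ sum {n} (λ i → embed (coeff f (toℕ i)) * β ^ toℕ i)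
    eval-as-sum f       zero    f< = eval-zero f (coeffwise λ i → f< i z≤n)
    eval-as-sum []      (suc n) f< = sym (trans (+-cong (trans (*-congʳ 0#-homo) (zeroˡ _)) (begin
      sum {n} (λ i → embed F.0# * β ^ suc (toℕ i))   ≈⟨ sum-cong-≋ {n} (λ i → trans (*-congʳ 0#-homo) (zeroˡ _)) ⟩
      sum {n} (λ _ → 0#)                             ≈⟨ sum-replicate-zero n ⟩
      0#                                             ∎)) (+-identityʳ 0#))
      where open import Algebra.Properties.CommutativeMonoid.Sum +-commutativeMonoid using (sum-replicate-zero)
    eval-as-sum (a ∷ f) (suc n) f< = +-cong (sym (*-identityʳ _)) (begin
      β * eval f β                                                   ≈⟨ *-congˡ (eval-as-sum f n (λ i n≤i → f< (suc i) (s≤s n≤i))) ⟩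
      β * sum {n} (λ i → embed (coeff f (toℕ i)) * β ^ toℕ i)        ≈⟨ *-distribˡ-sum {n} β (λ i → embed (coeff f (toℕ i)) * β ^ toℕ i) ⟩
      sum {n} (λ i → β * (embed (coeff f (toℕ i)) * β ^ toℕ i))      ≈⟨ sum-cong-≋ {n} (λ i → solve 3 (λ x a y → x :* (a :* y) := a :* (x :* y)) refl β _ _) ⟩
      sum {n} (λ i → embed (coeff f (toℕ i)) * β ^ suc (toℕ i))      ∎)

  module _ (β : Carrier) where

    eval-2X : eval (F.0# ∷ F.2# ∷ []) β ≈ 2# * β
    eval-2X = begin
      embed F.0# + β * (embed F.2# + β * 0#)   ≈⟨ +-cong 0#-homo (*-congˡ (+-congʳ (trans (+-homo F.1# F.1#) (+-cong 1#-homo 1#-homo)))) ⟩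
      0# + β * (2# + β * 0#)                   ≈⟨ solve 1 (λ x → κ 0 :+ x :* (κ 2 :+ x :* κ 0) := κ 2 :* x) refl β ⟩
      2# * β                                   ∎

    private
      term : Poly → (m : ℕ) → Fin (suc m) → Poly
      term f m i = (coeff f (toℕ i) ∷ []) *ₚ (F.0# ∷ F.2# ∷ []) P.^ (m ∸ toℕ i) *ₚ (F.1# ∷ F.0# ∷ F.1# ∷ []) P.^ toℕ i

      eval-term : ∀ f m i → eval (term f m i) β ≈ embed (coeff f (toℕ i)) * (2# * β) ^ (m ∸ toℕ i) * (β * β + 1#) ^ toℕ i
      eval-term f m i = begin
        eval (term f m i) β   ≈⟨ trans (eval-* β (C *ₚ 2X^) ((F.1# ∷ F.0# ∷ F.1# ∷ []) P.^ toℕ i)) (*-congʳ (eval-* β C 2X^)) ⟩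
        eval (coeff f (toℕ i) ∷ []) β * eval ((F.0# ∷ F.2# ∷ []) P.^ (m ∸ toℕ i)) β * eval ((F.1# ∷ F.0# ∷ F.1# ∷ []) P.^ toℕ i) β
          ≈⟨ *-cong (*-cong (eval-constant β _) (trans (eval-^ β (F.0# ∷ F.2# ∷ []) (m ∸ toℕ i)) (^-congˡ (m ∸ toℕ i) eval-2X))) (trans (eval-^ β (F.1# ∷ F.0# ∷ F.1# ∷ []) (toℕ i)) (^-congˡ (toℕ i) eval-X²+1)) ⟩
        embed (coeff f (toℕ i)) * (2# * β) ^ (m ∸ toℕ i) * (β * β + 1#) ^ toℕ i ∎
        where
        C = coeff f (toℕ i) ∷ []
        2X^ = (F.0# ∷ F.2# ∷ []) P.^ (m ∸ toℕ i)
        eval-X²+1 : eval (F.1# ∷ F.0# ∷ F.1# ∷ []) β ≈ β * β + 1#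
        eval-X²+1 = begin
          embed F.1# + β * (embed F.0# + β * (embed F.1# + β * 0#)) ≈⟨ +-cong 1#-homo (*-congˡ (+-cong 0#-homo (*-congˡ (+-congʳ 1#-homo)))) ⟩
          1# + β * (0# + β * (1# + β * 0#))        ≈⟨ solve 1 (λ x → κ 1 :+ x :* (κ 0 :+ x :* (κ 1 :+ x :* κ 0)) := x :* x :+ κ 1) refl β ⟩
          β * β + 1#                               ∎

    -- The hypothesis is θ = ½(β + β⁻¹) with denominators cleared. It turns (2β)^(m-i) (β² + 1)^i
    -- into (2β)^m θ^i, so a common factor comes out of the sum.
    eval-^R : ∀ f θ → 2# * β * θ ≈ β * β + 1# → eval (f ^R) β ≈ (2# * β) ^ degree f * eval f θ
    eval-^R f θ 2βθ≈β²+1 = begin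
      eval (f ^R) β                                                           ≈⟨ eval-sum β (term f m) ⟩
      sum (λ i → eval (term f m i) β)                                         ≈⟨ sum-cong-≋ {suc m} (λ i → eval-term′ i (ℕₚ.≤-pred (toℕ<n i))) ⟩
      sum {suc m} (λ i → (2# * β) ^ m * (embed (coeff f (toℕ i)) * θ ^ toℕ i)) ≈⟨ *-distribˡ-sum {suc m} ((2# * β) ^ m) (λ i → embed (coeff f (toℕ i)) * θ ^ toℕ i) ⟨
      (2# * β) ^ m * sum {suc m} (λ i → embed (coeff f (toℕ i)) * θ ^ toℕ i)  ≈⟨ *-congˡ (eval-as-sum θ f (suc m) (Degree≤-degree f)) ⟨
      (2# * β) ^ m * eval f θ                                                 ∎
      where
      m = degree f
      eval-term′ : ∀ i → toℕ i ≤ m → eval (term f m i) β ≈ (2# * β) ^ m * (embed (coeff f (toℕ i)) * θ ^ toℕ i)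
      eval-term′ i i≤m = begin
        eval (term f m i) β                                                      ≈⟨ eval-term f m i ⟩
        a * (2# * β) ^ (m ∸ toℕ i) * (β * β + 1#) ^ toℕ i                        ≈⟨ *-congˡ (trans (^-congˡ (toℕ i) (sym 2βθ≈β²+1)) (^-distrib-* _ θ (toℕ i))) ⟩
        a * (2# * β) ^ (m ∸ toℕ i) * ((2# * β) ^ toℕ i * θ ^ toℕ i)              ≈⟨ solve 4 (λ a x y z → a :* x :* (y :* z) := (x :* y) :* (a :* z)) refl _ _ _ _ ⟩
        (2# * β) ^ (m ∸ toℕ i) * (2# * β) ^ toℕ i * (a * θ ^ toℕ i)              ≈⟨ *-congʳ (^-homo-* (2# * β) (m ∸ toℕ i) (toℕ i)) ⟨
        (2# * β) ^ (m ∸ toℕ i ℕ.+ toℕ i) * (a * θ ^ toℕ i)                       ≡⟨ ≡.cong (λ k → (2# * β) ^ k * (a * θ ^ toℕ i)) (ℕₚ.m∸n+n≡m i≤m) ⟩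
        (2# * β) ^ m * (a * θ ^ toℕ i)                                           ∎
        where a = embed (coeff f (toℕ i))

    -- The terms with i < m contain the factor 2β, and the last one leaves the leading coefficient
    -- of f. Roots of `f ^R` are thus non-zero.
    eval-^R-at-0 : ∀ f → Monic f → β ≈ 0# → eval (f ^R) β ≈ 1#
    eval-^R-at-0 f f-monic β≈0 = begin
      eval (f ^R) β                       ≈⟨ eval-sum β (term f m) ⟩
      sum (λ i → eval (term f m i) β)     ≈⟨ sum-only-last +-commutativeMonoid m _ vanishing ⟩
      eval (term f m (Fin.fromℕ m)) β         ≈⟨ eval-term f m (Fin.fromℕ m) ⟩
      embed (coeff f (toℕ (Fin.fromℕ m))) * (2# * β) ^ (m ∸ toℕ (Fin.fromℕ m)) * (β * β + 1#) ^ toℕ (Fin.fromℕ m)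
                                          ≡⟨ ≡.cong (λ k → embed (coeff f k) * (2# * β) ^ (m ∸ k) * (β * β + 1#) ^ k) (toℕ-fromℕ m) ⟩
      embed (coeff f m) * (2# * β) ^ (m ∸ m) * (β * β + 1#) ^ m
                                          ≈⟨ *-cong (*-cong (trans (⟦⟧-cong f-monic) 1#-homo) (^-congʳ _ (ℕₚ.n∸n≡0 m))) (^-congˡ m (trans (+-congʳ (trans (*-congʳ β≈0) (zeroˡ β))) (+-identityˡ 1#))) ⟩
      1# * 1# * 1# ^ m                    ≈⟨ *-cong (*-identityʳ 1#) (1^n≈1 m) ⟩
      1# * 1#                             ≈⟨ *-identityʳ 1# ⟩
      1#                                  ∎
      where
      m = degree f
      vanishing : ∀ i → toℕ i < m → eval (term f m i) β ≈ 0#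
      vanishing i i<m = begin
        eval (term f m i) β               ≈⟨ eval-term f m i ⟩
        a * (2# * β) ^ (m ∸ toℕ i) * b    ≡⟨ ≡.cong (λ k → a * (2# * β) ^ k * b) (ℕₚ.+-∸-assoc 1 i<m) ⟩
        a * (2# * β * c) * b              ≈⟨ *-congʳ (*-congˡ (*-congʳ (*-congˡ β≈0))) ⟩
        a * (2# * 0# * c) * b             ≈⟨ solve 3 (λ a c b → a :* (κ 2 :* κ 0 :* c) :* b := κ 0) refl a c b ⟩
        0#                                ∎
        where
        a = embed (coeff f (toℕ i))
        b = (β * β + 1#) ^ toℕ i
        c = (2# * β) ^ (m ∸ suc (toℕ i))

module RDegree (F : Field) where
  open Polynomials F hiding (_∣_; sum; _^_; Irreducible)
  open PolynomialRing F
  private module P = Polynomials F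
  open Field F hiding (zero)
  open import Algebra.Properties.CommutativeMonoid.Sum +-commutativeMonoid using (sum)
  open import Relation.Binary.Reasoning.Setoid setoid

  Degree≤-^ : ∀ g {n} k → Degree≤ g n → Degree≤ (g P.^ k) (k ℕ.* n)
  Degree≤-^ g zero    g≤ (suc i) _ = refl
  Degree≤-^ g (suc k) g≤           = proj₁ (product-degree g (g P.^ k) g≤ (Degree≤-^ g k g≤))

  MonicOfDegree-* : ∀ f g {m n} → MonicOfDegree f m → MonicOfDegree g n → MonicOfDegree (f *ₚ g) (m ℕ.+ n)
  MonicOfDegree-* f g (f-top , f≤) (g-top , g≤) with fg≤ , fg-top ← product-degree f g f≤ g≤ =
    trans fg-top (trans (*-cong f-top g-top) (*-identityʳ 1#)) , fg≤

  MonicOfDegree-^ : ∀ g {n} k → MonicOfDegree g n → MonicOfDegree (g P.^ k) (k ℕ.* n)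
  MonicOfDegree-^ g zero    _       = refl , λ { (suc i) _ → refl }
  MonicOfDegree-^ g (suc k) g-monic = MonicOfDegree-* g (g P.^ k) g-monic (MonicOfDegree-^ g k g-monic)

  coeff-sum : ∀ {n} (t : Fin n → Poly) j → coeff (P.sum t) j ≈ sum (λ i → coeff (t i) j)
  coeff-sum {zero}  t j = refl
  coeff-sum {suc n} t j = trans (coeff-+ (t Fin.zero) (P.sum (t ∘ Fin.suc)) j) (+-congˡ (coeff-sum (t ∘ Fin.suc) j))

  -- The term of index i has degree at most m + i, so degree 2m is reached by i = m alone, where
  -- (2x)^0 leaves the leading coefficient of f times (x² + 1)^m.
  ^R-monic : ∀ f → Monic f → MonicOfDegree (f ^R) (2 ℕ.* degree f)
  ^R-monic f f-monic = trans (coeff-^R (2 ℕ.* m) ℕₚ.≤-refl) (proj₁ last-monic)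
                     , λ j lt → trans (coeff-^R j (ℕₚ.<⇒≤ lt)) (proj₂ last-monic j lt)
    where
    m = degree f
    2X X²+1 : Poly
    2X   = 0# ∷ 2# ∷ []
    X²+1 = 1# ∷ 0# ∷ 1# ∷ []

    term : ℕ → Poly
    term i = (coeff f i ∷ []) *ₚ 2X P.^ (m ∸ i) *ₚ X²+1 P.^ i

    constant≤ : ∀ a → Degree≤ (a ∷ []) 0
    constant≤ a (suc i) _ = refl

    2X≤ : Degree≤ 2X 1
    2X≤ (suc (suc i)) _ = refl
    2X≤ (suc zero) (s≤s ())

    X²+1-monic : MonicOfDegree X²+1 2
    X²+1-monic = refl , λ { (suc (suc (suc i))) _ → refl ; (suc (suc zero)) (s≤s (s≤s ())) ; (suc zero) (s≤s ()) }

    term≤ : ∀ i → Degree≤ (term i) ((m ∸ i) ℕ.* 1 ℕ.+ i ℕ.* 2)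
    term≤ i = proj₁ (product-degree ((coeff f i ∷ []) *ₚ 2X P.^ (m ∸ i)) (X²+1 P.^ i)
      (proj₁ (product-degree (coeff f i ∷ []) (2X P.^ (m ∸ i)) (constant≤ _) (Degree≤-^ 2X (m ∸ i) 2X≤)))
      (proj₂ (MonicOfDegree-^ X²+1 i X²+1-monic)))

    term-degree : ∀ i → i ≤ m → (m ∸ i) ℕ.* 1 ℕ.+ i ℕ.* 2 ≡ m ℕ.+ i
    term-degree i i≤m = ≡.trans
      (≡.cong₂ ℕ._+_ (ℕₚ.*-identityʳ (m ∸ i)) (≡.trans (ℕₚ.*-comm i 2) (≡.cong (i ℕ.+_) (ℕₚ.+-identityʳ i))))
      (≡.trans (≡.sym (ℕₚ.+-assoc (m ∸ i) i i)) (≡.cong (ℕ._+ i) (ℕₚ.m∸n+n≡m i≤m)))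

    last-monic : MonicOfDegree (term m) (2 ℕ.* m)
    last-monic = ≡.subst (MonicOfDegree (term m)) (ℕₚ.*-comm m 2)
      (MonicOfDegree-* ((coeff f m ∷ []) *ₚ 2X P.^ (m ∸ m)) (X²+1 P.^ m) leading (MonicOfDegree-^ X²+1 m X²+1-monic))
      where
      leading : MonicOfDegree ((coeff f m ∷ []) *ₚ 2X P.^ (m ∸ m)) 0
      leading = ≡.subst (λ k → MonicOfDegree ((coeff f m ∷ []) *ₚ 2X P.^ k) 0) (≡.sym (ℕₚ.n∸n≡0 m))
        (MonicOfDegree-* (coeff f m ∷ []) (1# ∷ []) (f-monic , constant≤ _) (refl , constant≤ _))

    coeff-^R : ∀ j → 2 ℕ.* m ≤ j → coeff (f ^R) j ≈ coeff (term m) j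
    coeff-^R j 2m≤j = begin
      coeff (f ^R) j                                  ≈⟨ coeff-sum (term ∘ toℕ {suc m}) j ⟩
      sum {suc m} (λ i → coeff (term (toℕ i)) j)      ≈⟨ sum-only-last +-commutativeMonoid m _ (λ i i<m → term≤ (toℕ i) j (small (toℕ i) i<m)) ⟩
      coeff (term (toℕ (Fin.fromℕ m))) j                  ≡⟨ ≡.cong (λ k → coeff (term k) j) (toℕ-fromℕ m) ⟩
      coeff (term m) j                                ∎
      where
      small : ∀ i → i < m → (m ∸ i) ℕ.* 1 ℕ.+ i ℕ.* 2 < j
      small i i<m = ℕₚ.<-≤-trans (≡.subst₂ _<_ (≡.sym (term-degree i (ℕₚ.<⇒≤ i<m))) (≡.cong (m ℕ.+_) (≡.sym (ℕₚ.+-identityʳ m))) (ℕₚ.+-monoʳ-< m i<m)) 2m≤j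

-- The Möbius map and squaring

module CayleyTransform (K : Field) (2≉0 : ¬ Field._≈_ K (Field.2# K) (Field.0# K)) where
  open Field K hiding (zero)
  open FieldProperties K
  open IntegerCoefficientSolver commutativeRing using (solve; κ; _:+_; _:*_; _:-_; :-_; _:=_)
  open ProjectiveLine K using (ϑ; Periodic; _≈∞_)
  open import Algebra.Properties.Group +-group using () renaming (x∙y⁻¹≈ε⇒x≈y to x-y≈0⇒x≈y; inverseˡ-unique to x+y≈0⇒x≈-y)
  open import Algebra.Properties.CommutativeSemiring.Exp commutativeSemiring
  open import Relation.Binary.Reasoning.Setoid setoid

  -- v is the image of x under the Möbius map x ↦ (x − 1)/(x + 1), which turns ϑ into squaring.
  infix 4 _↦_
  _↦_ : Carrier → Carrier → Set
  x ↦ v = v * (x + 1#) ≈ x - 1#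

  cayley : Carrier → Carrier
  cayley x = (x - 1#) * (x + 1#) ⁻¹

  x+1≉0 : ∀ {x} → x ≉ - 1# → x + 1# ≉ 0#
  x+1≉0 x≉-1 = x≉-1 ∘ x+y≈0⇒x≈-y _ _

  ↦-cayley : ∀ {x} → x ≉ - 1# → x ↦ cayley x
  ↦-cayley x≉-1 = trans (*-assoc _ _ _) (trans (*-congˡ (inverseˡ (x+1≉0 x≉-1))) (*-identityʳ _))

  ↦-resp : ∀ {x v w} → v ≈ w → x ↦ v → x ↦ w
  ↦-resp v≈w xv = trans (*-congʳ (sym v≈w)) xv

  -- The value 1 is taken by the Möbius map at infinity only.
  ↦⇒≉1 : ∀ {x v} → x ↦ v → v ≉ 1#
  ↦⇒≉1 {x} {v} xv v≈1 = 2≉0 (begin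
    2#                        ≈⟨ solve 1 (λ x → κ 2 := κ 1 :* (x :+ κ 1) :- (x :- κ 1)) refl x ⟩
    1# * (x + 1#) - (x - 1#)  ≈⟨ +-congʳ (trans (*-congʳ (sym v≈1)) xv) ⟩
    (x - 1#) - (x - 1#)       ≈⟨ -‿inverseʳ _ ⟩
    0#                        ∎)

  ↦-injective : ∀ {x y v} → x ↦ v → y ↦ v → x ≈ y
  ↦-injective {x} {y} {v} xv yv = *-cancelˡ-nonZero (↦⇒≉1 xv ∘ sym ∘ x-y≈0⇒x≈y _ _) (trans (solved xv) (sym (solved yv)))
    where
    solved : ∀ {x} → x ↦ v → (1# - v) * x ≈ 1# + v
    solved {x} xv = begin
      (1# - v) * x                    ≈⟨ solve 2 (λ v x → (κ 1 :- v) :* x := κ 1 :+ v :+ (x :- κ 1) :- v :* (x :+ κ 1)) refl v x ⟩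
      1# + v + (x - 1#) - v * (x + 1#) ≈⟨ +-congˡ (-‿cong xv) ⟩
      1# + v + (x - 1#) - (x - 1#)    ≈⟨ solve 2 (λ v x → κ 1 :+ v :+ (x :- κ 1) :- (x :- κ 1) := κ 1 :+ v) refl v x ⟩
      1# + v                          ∎

  cayley-nonZero : ∀ {x} → x ≉ - 1# → x ≉ 1# → cayley x ≉ 0#
  cayley-nonZero x≉-1 x≉1 c≈0 = x≉1 (x-y≈0⇒x≈y _ _ (trans (sym (↦-cayley x≉-1)) (trans (*-congʳ c≈0) (zeroˡ _))))

  -- The relation θ = ½(x + x⁻¹) without denominators; it forces x to be non-zero.
  Halves : Carrier → Carrier → Set
  Halves x θ = 2# * x * θ ≈ x * x + 1#

  halves-nonZero : ∀ {x θ} → Halves x θ → x ≉ 0#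
  halves-nonZero {x} {θ} h x≈0 = 0≉1 (begin
    0#             ≈⟨ solve 1 (λ θ → κ 0 := κ 2 :* κ 0 :* θ) refl θ ⟩
    2# * 0# * θ    ≈⟨ *-congʳ (*-congˡ x≈0) ⟨
    2# * x * θ     ≈⟨ h ⟩
    x * x + 1#     ≈⟨ +-congʳ (*-congʳ x≈0) ⟩
    0# * x + 1#    ≈⟨ solve 1 (λ x → κ 0 :* x :+ κ 1 := κ 1) refl x ⟩
    1#             ∎)

  -- From 2x(θ + 1) = (x + 1)² and 2x(θ - 1) = (x - 1)², the quotient gives ψ(θ) = ψ(x)².
  ↦-halves : ∀ {x θ v} → Halves x θ → x ↦ v → θ ↦ v * v
  ↦-halves {x} {θ} {v} h xv = *-cancelˡ-nonZero (*-nonZero 2≉0 (halves-nonZero h)) (begin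
    2# * x * (v * v * (θ + 1#))               ≈⟨ solve 3 (λ x v θ → κ 2 :* x :* (v :* v :* (θ :+ κ 1)) := v :* v :* (κ 2 :* x :* θ :+ κ 2 :* x)) refl x v θ ⟩
    v * v * (2# * x * θ + 2# * x)             ≈⟨ *-congˡ (+-congʳ h) ⟩
    v * v * (x * x + 1# + 2# * x)             ≈⟨ solve 2 (λ x v → v :* v :* (x :* x :+ κ 1 :+ κ 2 :* x) := (v :* (x :+ κ 1)) :* (v :* (x :+ κ 1))) refl x v ⟩
    (v * (x + 1#)) * (v * (x + 1#))           ≈⟨ *-cong xv xv ⟩
    (x - 1#) * (x - 1#)                       ≈⟨ solve 1 (λ x → (x :- κ 1) :* (x :- κ 1) := x :* x :+ κ 1 :- κ 2 :* x) refl x ⟩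
    x * x + 1# - 2# * x                       ≈⟨ +-congʳ h ⟨
    2# * x * θ - 2# * x                       ≈⟨ solve 2 (λ x θ → κ 2 :* x :* θ :- κ 2 :* x := κ 2 :* x :* (θ :- κ 1)) refl x θ ⟩
    2# * x * (θ - 1#)                         ∎)

  halve : Carrier → Carrier
  halve x = (2# * x) ⁻¹ * (x * x + 1#)

  halves-halve : ∀ {x} → x ≉ 0# → Halves x (halve x)
  halves-halve x≉0 = trans (sym (*-assoc _ _ _)) (trans (*-congʳ (inverseʳ (*-nonZero 2≉0 x≉0))) (*-identityˡ _))

  halves-sym : ∀ {x y θ} → x * y ≈ 1# → Halves x θ → Halves y θ
  halves-sym {x} {y} {θ} xy≈1 h = begin
    2# * y * θ                     ≈⟨ solve 2 (λ y θ → κ 2 :* y :* θ := κ 1 :* (κ 2 :* y :* θ)) refl y θ ⟩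
    1# * (2# * y * θ)              ≈⟨ *-congʳ xy≈1 ⟨
    x * y * (2# * y * θ)           ≈⟨ solve 3 (λ x y θ → x :* y :* (κ 2 :* y :* θ) := y :* y :* (κ 2 :* x :* θ)) refl x y θ ⟩
    y * y * (2# * x * θ)           ≈⟨ *-congˡ h ⟩
    y * y * (x * x + 1#)           ≈⟨ solve 2 (λ x y → y :* y :* (x :* x :+ κ 1) := y :* y :+ (x :* y) :* (x :* y)) refl x y ⟩
    y * y + (x * y) * (x * y)      ≈⟨ +-congˡ (trans (*-cong xy≈1 xy≈1) (*-identityʳ 1#)) ⟩
    y * y + 1#                     ∎

  -- The fixed points 1 and -1 of the halving map: a root s of a factor of `f ^R` lies over the root
  -- s of f.
  halves-±1 : ∀ {x θ s} → s * s ≈ 1# → x ≈ s → Halves x θ → θ ≈ s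
  halves-±1 {x} {θ} {s} s²≈1 x≈s h = *-cancelˡ-nonZero (*-nonZero 2≉0 s≉0) (begin
    2# * s * θ             ≈⟨ *-congʳ (*-congˡ x≈s) ⟨
    2# * x * θ             ≈⟨ h ⟩
    x * x + 1#             ≈⟨ +-cong (*-cong x≈s x≈s) (sym s²≈1) ⟩
    s * s + s * s          ≈⟨ solve 1 (λ s → s :* s :+ s :* s := κ 2 :* s :* s) refl s ⟩
    2# * s * s             ∎)
    where
    s≉0 : s ≉ 0#
    s≉0 s≈0 = 0≉1 (trans (sym (zeroˡ s)) (trans (*-congʳ (sym s≈0)) s²≈1))

  -- With k = 2r + 1, a is the inverse of (a²)^r and hence determined by a².
  square-injective : ∀ {k} → 2 ∤ℕ k → ∀ {a b} → a ^ k ≈ 1# → b ^ k ≈ 1# → a * a ≈ b * b → a ≈ b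
  square-injective 2∤k {a} {b} aᵏ≈1 bᵏ≈1 a²≈b² with r , ≡.refl ← odd⇒suc-double 2∤k =
    trans (inverse-unique (trans (*-comm _ _) (trans (sym (^-suc-double a r)) aᵏ≈1)))
     (sym (inverse-unique (trans (*-comm _ _) (trans (*-congˡ (^-congˡ r a²≈b²)) (trans (sym (^-suc-double b r)) bᵏ≈1)))))

  x^2≈xx : ∀ x → x ^ 2 ≈ x * x
  x^2≈xx x = *-congˡ (*-identityʳ x)

  ^-2^suc : ∀ x i → x ^ (2 ℕ.^ suc i) ≈ (x * x) ^ (2 ℕ.^ i)
  ^-2^suc x i = trans (sym (^-assocʳ x 2 (2 ℕ.^ i))) (^-congˡ (2 ℕ.^ i) (x^2≈xx x))

  ^-comm : ∀ x m n → (x ^ m) ^ n ≈ (x ^ n) ^ m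
  ^-comm x m n = trans (^-assocʳ x m n) (trans (^-congʳ x (ℕₚ.*-comm m n)) (sym (^-assocʳ x n m)))

  ^k≈1-^ : ∀ {a} k n → a ^ k ≈ 1# → (a ^ n) ^ k ≈ 1#
  ^k≈1-^ {a} k n aᵏ≈1 = trans (^-comm a n k) (trans (^-congˡ n aᵏ≈1) (1^n≈1 n))

  ^k≈1-square : ∀ {a} k → a ^ k ≈ 1# → (a * a) ^ k ≈ 1#
  ^k≈1-square {a} k aᵏ≈1 = trans (^-distrib-* a a k) (trans (*-cong aᵏ≈1 aᵏ≈1) (*-identityʳ 1#))

  2^-power-injective : ∀ {k} → 2 ∤ℕ k → ∀ i {a b} → a ^ k ≈ 1# → b ^ k ≈ 1# → a ^ (2 ℕ.^ i) ≈ b ^ (2 ℕ.^ i) → a ≈ b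
  2^-power-injective 2∤k zero    {a} {b} _ _ eq = trans (sym (*-identityʳ a)) (trans eq (*-identityʳ b))
  2^-power-injective {k} 2∤k (suc i) {a} {b} aᵏ≈1 bᵏ≈1 eq = square-injective 2∤k aᵏ≈1 bᵏ≈1
    (2^-power-injective 2∤k i (^k≈1-square k aᵏ≈1) (^k≈1-square k bᵏ≈1) (trans (sym (^-2^suc a i)) (trans eq (^-2^suc b i))))

  -- Two of the q + 1 powers v^(2^i) with i ≤ q agree. Squaring is injective on solutions of x^k = 1
  -- for odd k, so the common initial squarings cancel and v itself recurs.
  squaring-period : ∀ {q k} → HasCardinality K q → 2 ∤ℕ k → ∀ {v} → v ^ k ≈ 1# →
                    ∃[ M ] (0 < M × v ^ (2 ℕ.^ M) ≈ v)
  squaring-period {q} {k} finite 2∤k {v} vᵏ≈1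
    with i , j , i<j , same ← pigeonhole (ℕₚ.n<1+n q) (λ i → Inverse.to finite (v ^ (2 ℕ.^ toℕ i))) =
    M , ℕₚ.m<n⇒0<n∸m i<j , 2^-power-injective 2∤k (toℕ i) (^k≈1-^ k (2 ℕ.^ M) vᵏ≈1) vᵏ≈1 (begin
      (v ^ (2 ℕ.^ M)) ^ (2 ℕ.^ toℕ i)    ≈⟨ ^-assocʳ v (2 ℕ.^ M) (2 ℕ.^ toℕ i) ⟩
      v ^ (2 ℕ.^ M ℕ.* 2 ℕ.^ toℕ i)      ≡⟨ ≡.cong (v ^_) (≡.trans (≡.sym (ℕₚ.^-distribˡ-+-* 2 M (toℕ i))) (≡.cong (2 ℕ.^_) (ℕₚ.m∸n+n≡m (ℕₚ.<⇒≤ i<j)))) ⟩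
      v ^ (2 ℕ.^ toℕ j)                  ≈⟨ strictlyInverseʳ _ ⟨
      from (to (v ^ (2 ℕ.^ toℕ j)))      ≡⟨ ≡.cong from same ⟨
      from (to (v ^ (2 ℕ.^ toℕ i)))      ≈⟨ strictlyInverseʳ _ ⟩
      v ^ (2 ℕ.^ toℕ i)                  ∎)
    where
    open Inverse finite using (to; from; strictlyInverseʳ)
    M = toℕ j ∸ toℕ i

  -- The image of 0 is -1, whose odd powers differ from 1. So the orbit never meets 0, from where ϑ
  -- would lead to infinity.
  odd-order⇒nonZero : ∀ {k} → 2 ∤ℕ k → ∀ {x v} → x ↦ v → v ^ k ≈ 1# → x ≉ 0#
  odd-order⇒nonZero {k} 2∤k {x} {v} xv vᵏ≈1 x≈0 = 1≉-1 2≉0 (begin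
    1#           ≈⟨ vᵏ≈1 ⟨
    v ^ k        ≈⟨ ^-congˡ k v≈-1 ⟩
    (- 1#) ^ k   ≈⟨ [-1]^odd 2∤k ⟩
    - 1#         ∎)
    where
    v≈-1 : v ≈ - 1#
    v≈-1 = begin
      v              ≈⟨ solve 1 (λ v → v := v :* (κ 0 :+ κ 1)) refl v ⟩
      v * (0# + 1#)  ≈⟨ *-congˡ (+-congʳ x≈0) ⟨
      v * (x + 1#)   ≈⟨ xv ⟩
      x - 1#         ≈⟨ +-congʳ x≈0 ⟩
      0# - 1#        ≈⟨ +-identityˡ _ ⟩
      - 1#           ∎

  ϑ-just : ∀ x → x ≉ 0# → ∃[ y ] (ϑ (just x) ≡ just y × Halves x y)
  ϑ-just x x≉0 with x ≟ 0#
  ... | yes x≈0 = contradiction x≈0 x≉0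
  ... | no  _   = _ , ≡.refl , (begin
    2# * x * (2# ⁻¹ * (x + x ⁻¹))    ≈⟨ solve 4 (λ two x t y → two :* x :* (t :* (x :+ y)) := (two :* t) :* (x :* x :+ x :* y)) refl 2# x (2# ⁻¹) (x ⁻¹) ⟩
    2# * 2# ⁻¹ * (x * x + x * x ⁻¹)  ≈⟨ *-cong (inverseʳ 2≉0) (+-congˡ (inverseʳ x≉0)) ⟩
    1# * (x * x + 1#)                ≈⟨ *-identityˡ _ ⟩
    x * x + 1#                       ∎)

  -- Squaring preserves v^k = 1, so every point of the orbit is non-zero and ϑ remains conjugate to
  -- squaring along it.
  iterate-ϑ : ∀ {k} → 2 ∤ℕ k → ∀ j {x v} → x ↦ v → v ^ k ≈ 1# →
              ∃[ y ] (iterate ϑ (just x) j ≡ just y × y ↦ v ^ (2 ℕ.^ j))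
  iterate-ϑ 2∤k zero    {x} {v} xv _ = x , ≡.refl , ↦-resp (sym (*-identityʳ v)) xv
  iterate-ϑ {k} 2∤k (suc j) {x} {v} xv vᵏ≈1
    with y , ϑx≡y , h ← ϑ-just x (odd-order⇒nonZero 2∤k xv vᵏ≈1)
    with z , eq , zv ← iterate-ϑ 2∤k j (↦-halves h xv) (^k≈1-square k vᵏ≈1)
    = z , ≡.trans (≡.cong (λ t → iterate ϑ t j) ϑx≡y) eq , ↦-resp (sym (^-2^suc v j)) zv

  odd-order⇒periodic : ∀ {q k} → HasCardinality K q → 2 ∤ℕ k → ∀ {x v} → x ↦ v → v ^ k ≈ 1# → Periodic (just x)
  odd-order⇒periodic finite 2∤k {x} {v} xv vᵏ≈1
    with M , 0<M , vᴹ≈v ← squaring-period finite 2∤k vᵏ≈1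
    with y , eq , yv ← iterate-ϑ 2∤k M xv vᵏ≈1
    = M , 0<M , ≡.subst (_≈∞ just x) (≡.sym eq) (just (↦-injective (↦-resp vᴹ≈v yv) xv))

-- Root fields

module RootFields (F : Field) {p} (finite : HasCardinality F p) (2∤p : 2 ∤ℕ p) where
  open Polynomials F hiding (_^_; sum; eval)
  open PolynomialRing F
  private
    module F = Field F
    module P = Polynomials F
    module PR = CommutativeRing polynomialRing

  F-2≉0 : F.2# F.≉ F.0#
  F-2≉0 = FieldProperties.Finite.2≉0 F finite 2∤p

  module In (E : FiniteExtension F) where
    open FiniteExtension E using (K; embed; isRingHomomorphism) public
    open IsRingHomomorphism isRingHomomorphism
    open Evaluation F E public
    open Field K hiding (zero) public
    open FieldProperties K public
    open IntegerCoefficientSolver commutativeRing using (solve; κ; _:+_; _:*_; _:-_; :-_; _:=_) public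
    open import Algebra.Properties.Group +-group using (x≈y⇒x∙y⁻¹≈ε) renaming (x∙y⁻¹≈ε⇒x≈y to x-y≈0⇒x≈y; inverseˡ-unique to x+y≈0⇒x≈-y) public
    open import Algebra.Properties.CommutativeSemiring.Exp commutativeSemiring public
    open import Relation.Binary.Reasoning.Setoid setoid

    embed-1 : embed F.1# ≈ 1#
    embed-1 = 1#-homo

    embed--1 : embed (F.- F.1#) ≈ - 1#
    embed--1 = trans (-‿homo F.1#) (-‿cong 1#-homo)

    2≉0 : 2# ≉ 0#
    2≉0 2≈0 = 0≉1 (begin
      0#                                ≈⟨ zeroˡ _ ⟨
      0# * embed (F.2# F.⁻¹)            ≈⟨ *-congʳ (trans (+-homo F.1# F.1#) (trans (+-cong 1#-homo 1#-homo) 2≈0)) ⟨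
      embed F.2# * embed (F.2# F.⁻¹)    ≈⟨ *-homo _ _ ⟨
      embed (F.2# F.* F.2# F.⁻¹)        ≈⟨ ⟦⟧-cong (F.inverseʳ F-2≉0) ⟩
      embed F.1#                        ≈⟨ 1#-homo ⟩
      1#                                ∎)

    open CayleyTransform K 2≉0 public

    eval-linear : ∀ c β → eval (c ∷ F.1# ∷ []) β ≈ β + embed c
    eval-linear c β = begin
      embed c + β * (embed F.1# + β * 0#)  ≈⟨ +-congˡ (*-congˡ (+-congʳ 1#-homo)) ⟩
      embed c + β * (1# + β * 0#)          ≈⟨ solve 2 (λ c β → c :+ β :* (κ 1 :+ β :* κ 0) := β :+ c) refl _ β ⟩
      β + embed c                          ∎

    eval-difference : ∀ g c h β → eval (g +ₚ scale (F.- c) h) β ≈ eval g β - embed c * eval h β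
    eval-difference g c h β = begin
      eval (g +ₚ scale (F.- c) h) β              ≈⟨ eval-+ β g (scale (F.- c) h) ⟩
      eval g β + eval (scale (F.- c) h) β        ≈⟨ +-congˡ (eval-scale β (F.- c) h) ⟩
      eval g β + embed (F.- c) * eval h β        ≈⟨ +-congˡ (*-congʳ (-‿homo c)) ⟩
      eval g β + - embed c * eval h β            ≈⟨ solve 3 (λ g c h → g :+ :- c :* h := g :- c :* h) refl _ _ _ ⟩
      eval g β - embed c * eval h β              ∎

    eval-∣ : ∀ {g h} β → g ∣ h → eval g β ≈ 0# → eval h β ≈ 0#
    eval-∣ {g} {h} β record { quotient = s ; equality = sg≈h } gβ≈0 = begin
      eval h β               ≈⟨ eval-cong β {h} {s *ₚ g} (PR.sym (coeffwise sg≈h)) ⟩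
      eval (s *ₚ g) β        ≈⟨ eval-* β s g ⟩
      eval s β * eval g β    ≈⟨ *-congˡ gβ≈0 ⟩
      eval s β * 0#          ≈⟨ zeroʳ _ ⟩
      0#                     ∎

    powers-differ≈0 : ∀ {a b} → a ≈ b → a - embed F.1# * b ≈ 0#
    powers-differ≈0 a≈b = trans (+-congˡ (-‿cong (trans (*-congʳ embed-1) (*-identityˡ _)))) (x≈y⇒x∙y⁻¹≈ε a≈b)

    differ≈0⇒≈ : ∀ {a b} → a - embed F.1# * b ≈ 0# → a ≈ b
    differ≈0⇒≈ eq = trans (x-y≈0⇒x≈y _ _ eq) (trans (*-congʳ embed-1) (*-identityˡ _))

  X+1 X-1 : Poly
  X+1 = F.1# ∷ F.1# ∷ []
  X-1 = F.- F.1# ∷ F.1# ∷ []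

  -- A root β of Φ N c satisfies ((β − 1)/(β + 1))ᴺ = c.
  Φ : ℕ → F.Carrier → Poly
  Φ N c = X-1 P.^ N +ₚ scale (F.- c) (X+1 P.^ N)

  module _ (E : FiniteExtension F) where
    open In E
    open import Relation.Binary.Reasoning.Setoid setoid

    eval-Φ : ∀ N c {β v} → β ↦ v → eval (Φ N c) β ≈ (β + 1#) ^ N * (v ^ N - embed c)
    eval-Φ N c {β} {v} βv = begin
      eval (Φ N c) β                                      ≈⟨ eval-difference (X-1 P.^ N) c (X+1 P.^ N) β ⟩
      eval (X-1 P.^ N) β - embed c * eval (X+1 P.^ N) β   ≈⟨ +-cong (power X-1 (trans (eval-linear _ β) (trans (+-congˡ embed--1) (sym βv)))) (-‿cong (*-congˡ (power X+1 (trans (eval-linear _ β) (+-congˡ embed-1))))) ⟩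
      (v * (β + 1#)) ^ N - embed c * (β + 1#) ^ N         ≈⟨ +-congʳ (^-distrib-* v (β + 1#) N) ⟩
      v ^ N * (β + 1#) ^ N - embed c * (β + 1#) ^ N       ≈⟨ solve 3 (λ v b c → v :* b :- c :* b := b :* (v :- c)) refl _ _ _ ⟩
      (β + 1#) ^ N * (v ^ N - embed c)                    ∎
      where
      power : ∀ g {x} → eval g β ≈ x → eval (g P.^ N) β ≈ x ^ N
      power g gβ≈x = trans (eval-^ β g N) (^-congˡ N gβ≈x)

    Φ-root⇒power : ∀ N c {β v} → β ≉ - 1# → β ↦ v → eval (Φ N c) β ≈ 0# → v ^ N ≈ embed c
    Φ-root⇒power N c β≉-1 βv Φβ≈0 = x-y≈0⇒x≈y _ _ (zero-product (^-nonZero N (x+1≉0 β≉-1)) (trans (sym (eval-Φ N c βv)) Φβ≈0))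

    power⇒Φ-root : ∀ N c {β v} → β ↦ v → v ^ N ≈ embed c → eval (Φ N c) β ≈ 0#
    power⇒Φ-root N c βv vᴺ≈c = trans (eval-Φ N c βv) (trans (*-congˡ (x≈y⇒x∙y⁻¹≈ε vᴺ≈c)) (zeroʳ _))

  -- The residue field F[x]/(f) seen from outside: `α` is the class of x, and `lift` picks a
  -- polynomial in `α` for every element. All later arguments go through this interface.
  record Adjunction (f : Poly) (q : ℕ) : Set₁ where
    field
      E           : FiniteExtension F
    open In E
    field
      cardinality : HasCardinality K q
      α           : Carrier
      ∣⇒root      : ∀ {h} → f ∣ h → eval h α ≈ 0#
      root⇒∣      : ∀ {h} → eval h α ≈ 0# → f ∣ h
      lift        : Carrier → Poly
      eval-lift   : ∀ y → eval (lift y) α ≈ y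

  adjoin : ∀ {f d} → MonicOfDegree f d → Irreducible f → Adjunction f (p ℕ.^ d)
  adjoin {f} f-monic f-irreducible = record
    { E           = extension
    ; cardinality = cardinality
    ; α           = F.0# ∷ F.1# ∷ []
    ; ∣⇒root      = λ {h} f∣h → Q.trans (eval-X h) (∣⇒≈0 f∣h)
    ; root⇒∣      = λ {h} hα≈0 → ≈0⇒∣ (Q.trans (Q.sym (eval-X h)) hα≈0)
    ; lift        = λ h → h
    ; eval-lift   = eval-X
    }
    where
    open QuotientField F finite f f-monic f-irreducible
    module Q = Field quotientField

  -- Comparing degrees, the cofactor is 1 in degree 1 and would vanish in higher degree. This turns
  -- the exclusion of x + 1 and x - 1 into α ≠ -1 and α ≠ 1.
  linear-multiple : ∀ {f d c} → MonicOfDegree f d → 0 < d → f ∣ (c ∷ F.1# ∷ []) → f ≈ₚ c ∷ F.1# ∷ []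
  linear-multiple {f} {suc zero} {c} f-monic@(f-top , f≤) _ record { quotient = s ; equality = sf≈ } =
    at (PR.sym (x∙y⁻¹≈ε⇒x≈y (c ∷ F.1# ∷ []) f (PR.trans (PR.sym [s-1]f≈) (*ₚ-zeroˡ (s +ₚ negate PR.1#) f s-1≈0))))
    where
    open import Algebra.Properties.Group PR.+-group using (x∙y⁻¹≈ε⇒x≈y)
    [s-1]f≈ : (s +ₚ negate PR.1#) *ₚ f ≋ (c ∷ F.1# ∷ []) +ₚ negate f
    [s-1]f≈ = PR.trans (RingIdentities.[x-1]y≈xy-y polynomialRing s f) (PR.+-congʳ {negate f} (coeffwise sf≈))
    s-1≈0 : s +ₚ negate PR.1# ≋ []
    s-1≈0 = Euclid.multiple-small⇒zero F f f-monic (s +ₚ negate PR.1#) (λ i 1≤i →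
      F.trans (at [s-1]f≈ i) (F.trans (coeff-+ (c ∷ F.1# ∷ []) (negate f) i) (F.trans (F.+-congˡ (coeff-negate f i)) (small i 1≤i))))
      where
      small : ∀ i → 1 ≤ i → coeff (c ∷ F.1# ∷ []) i F.- coeff f i F.≈ F.0#
      small (suc zero)    _ = F.trans (F.+-congˡ (F.-‿cong f-top)) (F.-‿inverseʳ F.1#)
      small (suc (suc i)) _ = F.trans (F.+-congˡ (F.-‿cong (f≤ (suc (suc i)) (s≤s (s≤s z≤n))))) (F.-‿inverseʳ F.0#)
  linear-multiple {f} {suc (suc d)} {c} f-monic _ record { quotient = s ; equality = sf≈ } =
    contradiction (F.trans (F.sym (at (*ₚ-zeroˡ s f s≈0) 1)) (sf≈ 1)) F.0≉1
    where
    s≈0 : s ≋ []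
    s≈0 = Euclid.multiple-small⇒zero F f f-monic s (λ { (suc (suc i)) _ → sf≈ (suc (suc i)) ; (suc zero) (s≤s ()) })

  module _ {f q} (A : Adjunction f q) where
    open Adjunction A
    open In E

    -- A Bézout argument: if h(α) ≠ 0, lifting its inverse gives s with f ∣ hs - 1, and evaluation
    -- at the common root θ yields 1 = 0 in E′.
    minimal : ∀ (E′ : FiniteExtension F) {θ h} → Field._≈_ (FiniteExtension.K E′) (P.eval E′ f θ) (Field.0# (FiniteExtension.K E′)) →
              Field._≈_ (FiniteExtension.K E′) (P.eval E′ h θ) (Field.0# (FiniteExtension.K E′)) → f ∣ h
    minimal E′ {θ} {h} fθ≈0 hθ≈0 with eval h α ≟ 0#
    ... | yes hα≈0 = root⇒∣ hα≈0
    ... | no  hα≉0 = contradiction 1≈0 (K′.0≉1 ∘ K′.sym)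
      where
      module K′ = In E′
      s = lift (eval h α ⁻¹)
      hs-1 = h *ₚ s +ₚ scale (F.- F.1#) (F.1# ∷ [])
      f∣hs-1 : f ∣ hs-1
      f∣hs-1 = root⇒∣ (trans (eval-difference (h *ₚ s) F.1# (F.1# ∷ []) α) (powers-differ≈0
        (trans (eval-* α h s) (trans (*-congˡ (eval-lift _)) (trans (inverseʳ hα≉0) (sym (trans (eval-constant α F.1#) embed-1)))))))
      1≈0 : K′.1# K′.≈ K′.0#
      1≈0 = K′.trans (K′.sym (K′.trans (K′.eval-constant θ F.1#) K′.embed-1)) (K′.trans (K′.sym (K′.differ≈0⇒≈
          (K′.trans (K′.sym (K′.eval-difference (h *ₚ s) F.1# (F.1# ∷ []) θ)) (K′.eval-∣ {f} {hs-1} θ f∣hs-1 fθ≈0))))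
        (K′.trans (K′.eval-* θ h s) (K′.trans (K′.*-congʳ hθ≈0) (K′.zeroˡ _))))

    elements : Fin q → Poly
    elements i = lift (Inverse.from cardinality i)

    -- Equal values at θ make f divide the difference of the two lifts, hence equal classes. The
    -- values at θ thus form a copy of the residue field inside E′.
    elements-distinct : ∀ (E′ : FiniteExtension F) {θ} → Field._≈_ (FiniteExtension.K E′) (P.eval E′ f θ) (Field.0# (FiniteExtension.K E′)) →
      ∀ {i j} → Field._≈_ (FiniteExtension.K E′) (P.eval E′ (elements i) θ) (P.eval E′ (elements j) θ) → i ≡ j
    elements-distinct E′ {θ} fθ≈0 {i} {j} eq = Finite.from-injective cardinality
      (trans (sym (eval-lift _)) (trans (differ≈0⇒≈ (trans (sym (eval-difference (elements i) F.1# (elements j) α)) (∣⇒root f∣))) (eval-lift _)))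
      where
      module K′ = In E′
      f∣ : f ∣ elements i +ₚ scale (F.- F.1#) (elements j)
      f∣ = minimal E′ fθ≈0 (K′.trans (K′.eval-difference (elements i) F.1# (elements j) θ) (K′.powers-differ≈0 eq))

  module _ {f n} (A : Adjunction f (suc n)) where
    open Adjunction A
    open In E

    -- Fermat at α is the divisibility of h^q - h by f, q being the size of the residue field, and
    -- this can be evaluated at any root θ.
    elements-fermat : ∀ (E′ : FiniteExtension F) {θ} → let module K′ = In E′ in K′.eval f θ K′.≈ K′.0# →
      ∀ i → K′.eval (elements A i) θ K′.^ suc n K′.≈ K′.eval (elements A i) θ
    elements-fermat E′ {θ} fθ≈0 i = K′.trans (K′.sym (K′.eval-^ θ h (suc n))) (K′.differ≈0⇒≈
      (K′.trans (K′.sym (K′.eval-difference (h P.^ suc n) F.1# h θ)) (K′.eval-∣ {f} θ f∣ fθ≈0)))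
      where
      module K′ = In E′
      h = elements A i
      f∣ : f ∣ h P.^ suc n +ₚ scale (F.- F.1#) h
      f∣ = root⇒∣ (trans (eval-difference (h P.^ suc n) F.1# h α) (powers-differ≈0
        (trans (eval-^ α h (suc n)) (fermat′ cardinality (eval h α)))))

-- Passing from f to a factor of `f ^R`

module Steps (F : Field) {p} (finite : HasCardinality F p) (2∤p : 2 ∤ℕ p) where
  open Polynomials F hiding (_^_; sum; eval)
  open PolynomialRing F using (MonicOfDegree; at; coeffwise; monic⇒MonicOfDegree; MonicOfDegree⇒degree; MonicOfDegree⇒monic; MonicOfDegree-cong; scale)
  open RootFields F finite 2∤p
  open RDegree F using (^R-monic)
  private
    module F = Field F
    module P = Polynomials F

  -- The two inequations keep α off the pole and the zero of the Möbius map, so that `unit` is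
  -- meaningful and non-zero.
  record Stage (f : Poly) (q : ℕ) : Set₁ where
    field
      adjunction : Adjunction f q
    open Adjunction adjunction public
    open In E
    field
      α≉-1 : α ≉ - 1#
      α≉1  : α ≉ 1#

    unit : Carrier
    unit = cayley α

    α↦unit : α ↦ unit
    α↦unit = ↦-cayley α≉-1

    unit≉0 : unit ≉ 0#
    unit≉0 = cayley-nonZero α≉-1 α≉1

  -- Equivalent to `unit` ^ N = c, but phrased over F, so that it can be evaluated at any root of f
  -- in any extension.
  Level : Poly → ℕ → F.Carrier → Set
  Level f N c = f ∣ Φ N c

  module _ {f q} (S : Stage f q) where
    open Stage S
    open In E

    level⇒power : ∀ N c → Level f N c → unit ^ N ≈ embed c
    level⇒power N c lvl = Φ-root⇒power E N c α≉-1 α↦unit (∣⇒root lvl)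

    power⇒level : ∀ N c → unit ^ N ≈ embed c → Level f N c
    power⇒level N c uᴺ≈c = root⇒∣ (power⇒Φ-root E N c α↦unit uᴺ≈c)

    module _ (E′ : FiniteExtension F) where
      private module K′ = In E′

      -- If θ = -c, then by minimality f divides x + c, and α = -c as well.
      root-avoids : ∀ c {θ} → K′.eval f θ K′.≈ K′.0# → α + embed c ≉ 0# → θ K′.+ K′.embed c K′.≉ K′.0#
      root-avoids c {θ} fθ≈0 α+c≉0 θ+c≈0 = α+c≉0 (trans (sym (eval-linear c α))
        (∣⇒root {c ∷ F.1# ∷ []} (minimal adjunction E′ fθ≈0 (K′.trans (K′.eval-linear c θ) θ+c≈0))))

      root≉-1 : ∀ {θ} → K′.eval f θ K′.≈ K′.0# → θ K′.≉ K′.- K′.1#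
      root≉-1 {θ} fθ≈0 θ≈-1 = root-avoids F.1# fθ≈0
        (λ eq → α≉-1 (x+y≈0⇒x≈-y _ _ (trans (+-congˡ (sym embed-1)) eq)))
        (K′.trans (K′.+-cong θ≈-1 K′.embed-1) (K′.-‿inverseˡ K′.1#))

      root≉1 : ∀ {θ} → K′.eval f θ K′.≈ K′.0# → θ K′.≉ K′.1#
      root≉1 {θ} fθ≈0 θ≈1 = root-avoids (F.- F.1#) fθ≈0
        (λ eq → α≉1 (x-y≈0⇒x≈y _ _ (trans (+-congˡ (sym embed--1)) eq)))
        (K′.trans (K′.+-cong θ≈1 K′.embed--1) (K′.-‿inverseʳ K′.1#))

  irr⇒stage : ∀ {f d} → 0 < d → Irr d f → Stage f (p ℕ.^ d)
  irr⇒stage {f} {d} 0<d irr = record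
    { adjunction = A
    ; α≉-1 = λ α≈-1 → ≉x+1 (linear-multiple f-monic 0<d (root⇒∣
        (trans (eval-linear _ α) (trans (+-cong α≈-1 embed-1) (-‿inverseˡ 1#)))))
    ; α≉1  = λ α≈1 → ≉x-1 (linear-multiple f-monic 0<d (root⇒∣
        (trans (eval-linear _ α) (trans (+-cong α≈1 embed--1) (-‿inverseʳ 1#)))))
    }
    where
    open Irr irr
    f-monic : MonicOfDegree f d
    f-monic = ≡.subst (MonicOfDegree f) degree≡m (monic⇒MonicOfDegree f monic)
    A = adjoin f-monic irreducible
    open Adjunction A
    open In E

  -- The field of β contains the root θ = ½(β + β⁻¹) of f, not α itself; what is known about α
  -- reaches θ through divisibility by f.
  module Descent {f g q r} (S : Stage f q) (f-monic : Monic f) (A : Adjunction g r) (g∣f^R : g ∣ f ^R) where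
    open Adjunction A renaming (α to β)
    open In E

    f^Rβ≈0 : eval (f ^R) β ≈ 0#
    f^Rβ≈0 = ∣⇒root g∣f^R

    β≉0 : β ≉ 0#
    β≉0 β≈0 = 0≉1 (trans (sym f^Rβ≈0) (eval-^R-at-0 β f f-monic β≈0))

    θ : Carrier
    θ = halve β

    β-halves-θ : Halves β θ
    β-halves-θ = halves-halve β≉0

    fθ≈0 : eval f θ ≈ 0#
    fθ≈0 = zero-product (^-nonZero (degree f) (*-nonZero 2≉0 β≉0)) (trans (sym (eval-^R β f θ β-halves-θ)) f^Rβ≈0)

    β≉-1 : β ≉ - 1#
    β≉-1 β≈-1 = root≉-1 S E fθ≈0 (halves-±1 (solve 0 (:- κ 1 :* :- κ 1 := κ 1) refl) β≈-1 β-halves-θ)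

    β≉1 : β ≉ 1#
    β≉1 β≈1 = root≉1 S E fθ≈0 (halves-±1 (*-identityʳ 1#) β≈1 β-halves-θ)

    stage : Stage g r
    stage = record { adjunction = A ; α≉-1 = β≉-1 ; α≉1 = β≉1 }

    open Stage stage using (unit; α↦unit)

    -- Since ψ(β)² = ψ(θ), the exponent 2N at β is the exponent N at θ, where the level of f
    -- applies.
    level-double : ∀ N c → Level f N c → Level g (2 ℕ.* N) c
    level-double N c lvl = power⇒level stage (2 ℕ.* N) c (trans (sym (^-assocʳ unit 2 N)) (trans (^-congˡ N (x^2≈xx unit))
      (Φ-root⇒power E N c (root≉-1 S E fθ≈0) (↦-halves β-halves-θ α↦unit) (eval-∣ {f} {Φ N c} θ lvl fθ≈0))))

    next-irr : ∀ {d} → Monic g → degree g ≡ d → Irreducible g → Irr d g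
    next-irr g-monic deg irr = record
      { monic = g-monic ; degree≡m = deg ; irreducible = irr
      ; ≉x+1 = λ g≈X+1 → β≉-1 (x+y≈0⇒x≈-y _ _ (trans (+-congˡ (sym embed-1)) (β+c≈0 F.1# g≈X+1)))
      ; ≉x-1 = λ g≈X-1 → β≉1 (x-y≈0⇒x≈y _ _ (trans (+-congˡ (sym embed--1)) (β+c≈0 (F.- F.1#) g≈X-1)))
      }
      where
      β+c≈0 : ∀ c → g ≈ₚ c ∷ F.1# ∷ [] → β + embed c ≈ 0#
      β+c≈0 c g≈ = trans (sym (eval-linear c β)) (trans (eval-cong β {c ∷ F.1# ∷ []} {g} (coeffwise (F.sym ∘ g≈)))
        (∣⇒root {g} record { quotient = F.1# ∷ [] ; equality = at (PR.*ₚ-identityˡ g) }))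
        where module PR = PolynomialRing F

  -- If f ^R is irreducible, its root field has the q elements h(θ), all satisfying y^q = y, and
  -- u is none of them: h(θ) = u would survive the exchange of the roots β and β⁻¹, which negates u.
  unit-power≉1 : ∀ {f g q r} → Stage f (suc (suc q)) → Monic f → Adjunction g r → g ∣ f ^R → f ^R ∣ g →
                 ¬ Level g (suc q) F.1#
  unit-power≉1 {f} {g} {q} S f-monic A g∣f^R f^R∣g lvl = few-solutions-of-x^q≈x q solutions distinct solves
    where
    open Descent S f-monic A g∣f^R
    open Adjunction A using (E; root⇒∣) renaming (α to β)
    open Stage stage using (unit; α↦unit)
    open In E
    open import Relation.Binary.Reasoning.Setoid setoid

    el : Fin (suc (suc q)) → Poly
    el = elements (Stage.adjunction S)

    γ : Carrier
    γ = β ⁻¹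

    γ-halves-θ : Halves γ θ
    γ-halves-θ = halves-sym (inverseʳ β≉0) β-halves-θ

    -- γ lies over the same θ as β, so it is a root of `f ^R`; divisibility of g by `f ^R` makes it
    -- a conjugate of β.
    gγ≈0 : eval g γ ≈ 0#
    gγ≈0 = eval-∣ {f ^R} {g} γ f^R∣g (trans (eval-^R γ f θ γ-halves-θ) (trans (*-congˡ fθ≈0) (zeroʳ _)))

    unit-not-element : ∀ h → eval h θ ≉ unit
    unit-not-element h hθ≈u = β≉1 (x-y≈0⇒x≈y _ _ (zero-product 2≉0 (begin
      2# * (β - 1#)                                 ≈⟨ solve 1 (λ β → κ 2 :* (β :- κ 1) := (β :- κ 1) :- (κ 1 :- β)) refl β ⟩
      (β - 1#) - (1# - β)                           ≈⟨ +-cong (sym β-relation) (-‿cong (sym γ-relation)) ⟩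
      eval h θ * (β + 1#) - eval h θ * (1# + β)     ≈⟨ solve 2 (λ β h → h :* (β :+ κ 1) :- h :* (κ 1 :+ β) := κ 0) refl β (eval h θ) ⟩
      0#                                            ∎)))
      where
      β-relation : eval h θ * (β + 1#) ≈ β - 1#
      β-relation = trans (*-congʳ hθ≈u) α↦unit

      -- H is h(θ)(x + 1) - (x - 1) multiplied by (2x)^deg h: through `h ^R` it becomes a polynomial
      -- in x over F. It vanishes at β, so g divides it and it vanishes at γ too.
      2Xᵏ H : Poly
      2Xᵏ = (F.0# ∷ F.2# ∷ []) P.^ degree h
      H = (h ^R *ₚ X+1) +ₚ scale (F.- F.1#) (2Xᵏ *ₚ X-1)

      eval-2Xᵏ : ∀ x → eval 2Xᵏ x ≈ (2# * x) ^ degree h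
      eval-2Xᵏ x = trans (eval-^ x (F.0# ∷ F.2# ∷ []) (degree h)) (^-congˡ (degree h) (eval-2X x))

      eval-H : ∀ x → Halves x θ → eval H x ≈ (2# * x) ^ degree h * (eval h θ * (x + 1#) - (x - 1#))
      eval-H x x-halves-θ = begin
        eval H x                                                            ≈⟨ eval-difference (h ^R *ₚ X+1) F.1# (2Xᵏ *ₚ X-1) x ⟩
        eval (h ^R *ₚ X+1) x - embed F.1# * eval (2Xᵏ *ₚ X-1) x             ≈⟨ +-cong (eval-* x (h ^R) X+1) (-‿cong (trans (*-congʳ embed-1) (trans (*-identityˡ _) (eval-* x 2Xᵏ X-1)))) ⟩
        eval (h ^R) x * eval X+1 x - eval 2Xᵏ x * eval X-1 x                ≈⟨ +-cong (*-cong (eval-^R x h θ x-halves-θ) (trans (eval-linear _ x) (+-congˡ embed-1)))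
                                                                                    (-‿cong (*-cong (eval-2Xᵏ x) (trans (eval-linear _ x) (+-congˡ embed--1)))) ⟩
        (2# * x) ^ degree h * eval h θ * (x + 1#) - (2# * x) ^ degree h * (x - 1#) ≈⟨ solve 3 (λ x h t → t :* h :* (x :+ κ 1) :- t :* (x :- κ 1) := t :* (h :* (x :+ κ 1) :- (x :- κ 1))) refl x _ _ ⟩
        (2# * x) ^ degree h * (eval h θ * (x + 1#) - (x - 1#))              ∎

      Hγ≈0 : eval H γ ≈ 0#
      Hγ≈0 = eval-∣ {g} {H} γ (root⇒∣ (trans (eval-H β β-halves-θ) (trans (*-congˡ (x≈y⇒x∙y⁻¹≈ε β-relation)) (zeroʳ _)))) gγ≈0

      γ-relation : eval h θ * (1# + β) ≈ 1# - β
      γ-relation = begin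
        eval h θ * (1# + β)            ≈⟨ *-congˡ (+-congʳ (inverseʳ β≉0)) ⟨
        eval h θ * (β * γ + β)         ≈⟨ solve 3 (λ h β γ → h :* (β :* γ :+ β) := β :* (h :* (γ :+ κ 1))) refl _ β γ ⟩
        β * (eval h θ * (γ + 1#))      ≈⟨ *-congˡ (x-y≈0⇒x≈y _ _ (zero-product (^-nonZero (degree h) (*-nonZero 2≉0 (halves-nonZero γ-halves-θ))) (trans (sym (eval-H γ γ-halves-θ)) Hγ≈0))) ⟩
        β * (γ - 1#)                   ≈⟨ solve 2 (λ β γ → β :* (γ :- κ 1) := β :* γ :- β) refl β γ ⟩
        β * γ - β                      ≈⟨ +-congʳ (inverseʳ β≉0) ⟩
        1# - β                         ∎

    solutions : Fin (suc (suc (suc q))) → Carrier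
    solutions Fin.zero    = unit
    solutions (Fin.suc i) = eval (el i) θ

    distinct : ∀ {i j} → solutions i ≈ solutions j → i ≡ j
    distinct {Fin.zero}  {Fin.zero}  eq = ≡.refl
    distinct {Fin.zero}  {Fin.suc j} eq = contradiction (sym eq) (unit-not-element (el j))
    distinct {Fin.suc i} {Fin.zero}  eq = contradiction eq (unit-not-element (el i))
    distinct {Fin.suc i} {Fin.suc j} eq = ≡.cong Fin.suc (elements-distinct (Stage.adjunction S) E fθ≈0 eq)

    solves : ∀ i → solutions i ^ suc (suc q) ≈ solutions i
    solves Fin.zero    = trans (*-congˡ (trans (level⇒power stage (suc q) F.1# lvl) embed-1)) (*-identityʳ unit)
    solves (Fin.suc i) = elements-fermat (Stage.adjunction S) E fθ≈0 i

-- 2-adic valuations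

odd-* : ∀ {m n} → 2 ∤ℕ m → 2 ∤ℕ n → 2 ∤ℕ m ℕ.* n
odd-* {m} {n} 2∤m 2∤n 2∣mn with euclidsLemma m n prime[2] 2∣mn
... | inj₁ 2∣m = 2∤m 2∣m
... | inj₂ 2∣n = 2∤n 2∣n

odd⇒coprime-2 : ∀ {k} → 2 ∤ℕ k → Coprime k 2
odd⇒coprime-2 2∤k (d∣k , d∣2) with prime⇒irreducible prime[2] d∣2
... | inj₁ d≡1    = d≡1
... | inj₂ ≡.refl = contradiction d∣k 2∤k

odd-divisor : ∀ {k} → 2 ∤ℕ k → ∀ e {m} → k ∣ℕ 2 ℕ.^ e ℕ.* m → k ∣ℕ m
odd-divisor     2∤k zero    {m} k∣ = ≡.subst (_ ∣ℕ_) (ℕₚ.*-identityˡ m) k∣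
odd-divisor {k} 2∤k (suc e) {m} k∣ = odd-divisor 2∤k e
  (coprime-divisor (odd⇒coprime-2 2∤k) (≡.subst (k ∣ℕ_) (ℕₚ.*-assoc 2 (2 ℕ.^ e) m) k∣))

module Orders (p k : ℕ) where

  -- ν₂ (p ^ d ∸ 1) = e, with an odd part divisible by k, which will be the odd part of p ^ n ∸ 1.
  record Order (d e : ℕ) : Set where
    field
      cofactor : ℕ
      order    : p ℕ.^ d ≡ suc (2 ℕ.^ e ℕ.* (k ℕ.* cofactor))
      odd      : 2 ∤ℕ k ℕ.* cofactor

  square-pred : ∀ d {m} → p ℕ.^ d ≡ suc m → p ℕ.^ (2 ℕ.* d) ≡ suc (m ℕ.* (2 ℕ.+ m))
  square-pred d {m} pᵈ≡ = begin
    p ℕ.^ (d ℕ.+ (d ℕ.+ 0))       ≡⟨ ≡.cong (λ x → p ℕ.^ (d ℕ.+ x)) (ℕₚ.+-identityʳ d) ⟩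
    p ℕ.^ (d ℕ.+ d)               ≡⟨ ℕₚ.^-distribˡ-+-* p d d ⟩
    p ℕ.^ d ℕ.* p ℕ.^ d           ≡⟨ ≡.cong₂ ℕ._*_ pᵈ≡ pᵈ≡ ⟩
    suc m ℕ.* suc m               ≡⟨ expand m ⟩
    suc (m ℕ.* (2 ℕ.+ m))         ∎
    where
    open ≡.≡-Reasoning
    expand : ∀ m → (1 ℕ.+ m) ℕ.* (1 ℕ.+ m) ≡ 1 ℕ.+ m ℕ.* (2 ℕ.+ m)
    expand = solve-∀

  -- As 4 divides m = p ^ d − 1, exactly one factor 2 is gained in p ^ 2d − 1 = m (m + 2).
  order-double : ∀ {d e} → 2 ≤ e → Order d e → Order (2 ℕ.* d) (suc e)
  order-double {d} {suc (suc e)} _ o = record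
    { cofactor = j ℕ.* suc (2 ℕ.* (2 ℕ.^ e ℕ.* (k ℕ.* j)))
    ; order    = ≡.trans (square-pred d order) (≡.cong suc (factored (2 ℕ.^ e) k j))
    ; odd      = ≡.subst (2 ∤ℕ_) (ℕₚ.*-assoc k j _) (odd-* odd (2∤suc-double (2 ℕ.^ e ℕ.* (k ℕ.* j))))
    }
    where
    open Order o renaming (cofactor to j)
    factored : ∀ x k j → 2 ℕ.* (2 ℕ.* x) ℕ.* (k ℕ.* j) ℕ.* (2 ℕ.+ 2 ℕ.* (2 ℕ.* x) ℕ.* (k ℕ.* j))
             ≡ 2 ℕ.* (2 ℕ.* (2 ℕ.* x)) ℕ.* (k ℕ.* (j ℕ.* (1 ℕ.+ 2 ℕ.* (x ℕ.* (k ℕ.* j)))))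
    factored = solve-∀
    2∤suc-double : ∀ x → 2 ∤ℕ suc (2 ℕ.* x)
    2∤suc-double x 2∣ = contradiction
      (∣1⇒≡1 (∣m+n∣m⇒∣n {2} {2 ℕ.* x} {1} (≡.subst (2 ∣ℕ_) (ℕₚ.+-comm 1 (2 ℕ.* x)) 2∣) (m∣m*n x))) λ ()
  order-double {e = suc zero} (s≤s ()) _

  order-tower : ∀ {d e} → 2 ≤ e → Order d e → ∀ j → Order (2 ℕ.^ j ℕ.* d) (e ℕ.+ j)
  order-tower {d} {e} 2≤e o zero    = ≡.subst₂ Order (≡.sym (ℕₚ.*-identityˡ d)) (≡.sym (ℕₚ.+-identityʳ e)) o
  order-tower {d} {e} 2≤e o (suc j) = ≡.subst₂ Order (≡.sym (ℕₚ.*-assoc 2 (2 ℕ.^ j) d)) (≡.sym (ℕₚ.+-suc e j))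
    (order-double (ℕₚ.≤-trans 2≤e (ℕₚ.m≤m+n e j)) (order-tower 2≤e o j))

-- The 2-adic level along the sequence

module Dynamics (F : Field) {p} (finite : HasCardinality F p) (2∤p : 2 ∤ℕ p) {k} (2∤k : 2 ∤ℕ k) where
  open Polynomials F hiding (_^_; sum; eval)
  open PolynomialRing F using (MonicOfDegree; at; coeffwise; monic⇒MonicOfDegree; MonicOfDegree⇒degree; MonicOfDegree⇒monic; MonicOfDegree-cong; *ₚ-identityˡ; polynomialRing)
  open RootFields F finite 2∤p
  open Steps F finite 2∤p
  open RDegree F using (^R-monic)
  open Orders p k
  private module F = Field F

  -- As k is odd, the order of the unit has 2-adic valuation a + 1.
  Level⁻ : ℕ → Poly → Set
  Level⁻ a f = Level f (2 ℕ.^ a ℕ.* k) (F.- F.1#)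

  State : ℕ → ℕ → Poly → Set
  State d a f = Irr d f × Level⁻ a f

  stage-of-order : ∀ {f d e} → 0 < d → Irr d f → (o : Order d e) → Stage f (suc (2 ℕ.^ e ℕ.* (k ℕ.* Order.cofactor o)))
  stage-of-order {f} 0<d irr o = ≡.subst (Stage f) (Order.order o) (irr⇒stage 0<d irr)

  module _ {f q} (S : Stage f q) where
    open Stage S
    open In E

    level⁻-square : ∀ N → Level f N (F.- F.1#) → Level f (N ℕ.* 2) F.1#
    level⁻-square N lvl = power⇒level S (N ℕ.* 2) F.1# (begin
      unit ^ (N ℕ.* 2)      ≈⟨ ^-assocʳ unit N 2 ⟨
      (unit ^ N) ^ 2        ≈⟨ ^-congˡ 2 (trans (level⇒power S N (F.- F.1#) lvl) embed--1) ⟩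
      (- 1#) ^ 2            ≈⟨ solve 0 (:- κ 1 :* (:- κ 1 :* κ 1) := κ 1) refl ⟩
      1#                    ≈⟨ embed-1 ⟨
      embed F.1#            ∎)
      where open import Relation.Binary.Reasoning.Setoid setoid

    level-first-sign : ∀ e → unit ^ (2 ℕ.^ e ℕ.* k) ≈ 1# → Level f k F.1# ⊎ ∃[ a ] (a < e × Level⁻ a f)
    level-first-sign e eq with first-sign k e eq
    ... | inj₁ uᵏ≈1             = inj₁ (power⇒level S k F.1# (trans uᵏ≈1 (sym embed-1)))
    ... | inj₂ (a , a<e , u≈-1) = inj₂ (a , a<e , power⇒level S (2 ℕ.^ a ℕ.* k) (F.- F.1#) (trans u≈-1 (sym embed--1)))

    -- The non-periodic root may lie in any extension; the level, being a divisibility, applies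
    -- there.
    odd-order-root-periodic : Level f k F.1# → ¬ HasNonPeriodicRoot f
    odd-order-root-periodic lvl (E′ , β , fβ≈0 , nonperiodic) =
      nonperiodic (K′.odd-order⇒periodic (FiniteExtension.cardinality E′) 2∤k β↦v
        (K′.trans (Φ-root⇒power E′ k F.1# β≉-1 β↦v (K′.eval-∣ {f} {Φ k F.1#} β lvl fβ≈0)) K′.embed-1))
      where
      module K′ = In E′
      β≉-1 : β K′.≉ K′.- K′.1#
      β≉-1 = root≉-1 S E′ fβ≈0
      β↦v : β K′.↦ K′.cayley β
      β↦v = K′.↦-cayley β≉-1

  -- If e ≤ a, the power of the unit with exponent 2^a k j is 1 by Fermat, but also (-1)^j = -1, j
  -- being odd.
  level-bound : ∀ {f e a j} → 2 ∤ℕ k ℕ.* j → Stage f (suc (2 ℕ.^ e ℕ.* (k ℕ.* j))) → Level⁻ a f → a < e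
  level-bound {f} {e} {a} {j} odd S lvl = ℕₚ.≰⇒> λ e≤a → 1≉-1 2≉0 (begin
    1#                                         ≈⟨ 1^n≈1 (2 ℕ.^ (a ∸ e)) ⟨
    1# ^ (2 ℕ.^ (a ∸ e))                       ≈⟨ ^-congˡ (2 ℕ.^ (a ∸ e)) (fermat cardinality unit≉0) ⟨
    (unit ^ (2 ℕ.^ e ℕ.* (k ℕ.* j))) ^ (2 ℕ.^ (a ∸ e)) ≈⟨ ^-assocʳ unit (2 ℕ.^ e ℕ.* (k ℕ.* j)) (2 ℕ.^ (a ∸ e)) ⟩
    unit ^ (2 ℕ.^ e ℕ.* (k ℕ.* j) ℕ.* 2 ℕ.^ (a ∸ e)) ≡⟨ ≡.cong (unit ^_) (exponents e≤a) ⟩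
    unit ^ (2 ℕ.^ a ℕ.* k ℕ.* j)               ≈⟨ ^-assocʳ unit (2 ℕ.^ a ℕ.* k) j ⟨
    (unit ^ (2 ℕ.^ a ℕ.* k)) ^ j               ≈⟨ ^-congˡ j (trans (level⇒power S (2 ℕ.^ a ℕ.* k) (F.- F.1#) lvl) embed--1) ⟩
    (- 1#) ^ j                                 ≈⟨ [-1]^odd (odd ∘ ∣n⇒∣m*n k) ⟩
    - 1#                                       ∎)
    where
    open Stage S
    open In E
    open import Relation.Binary.Reasoning.Setoid setoid
    rearrange : ∀ x k j y → x ℕ.* (k ℕ.* j) ℕ.* y ≡ y ℕ.* x ℕ.* k ℕ.* j
    rearrange = solve-∀
    exponents : e ≤ a → 2 ℕ.^ e ℕ.* (k ℕ.* j) ℕ.* 2 ℕ.^ (a ∸ e) ≡ 2 ℕ.^ a ℕ.* k ℕ.* j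
    exponents e≤a = ≡.trans (rearrange (2 ℕ.^ e) k j (2 ℕ.^ (a ∸ e)))
      (≡.cong (λ x → x ℕ.* k ℕ.* j) (≡.trans (≡.sym (ℕₚ.^-distribˡ-+-* 2 (a ∸ e) e)) (≡.cong (2 ℕ.^_) (ℕₚ.m∸n+n≡m e≤a))))

  -- N divides the size of the unit group of the field of f, so `unit` ^ N = 1 for g would
  -- contradict `unit-power≉1`.
  order-bound : ∀ {f g e j r} → 2 ∤ℕ k ℕ.* j → Stage f (suc (2 ℕ.^ e ℕ.* (k ℕ.* j))) → Monic f → Adjunction g r →
                g ∣ f ^R → f ^R ∣ g → ∀ N → N ∣ℕ 2 ℕ.^ e ℕ.* k → ¬ Level g N F.1#
  order-bound {f} {g} {e} {j} {r} odd S f-monic A g∣f^R f^R∣g N (dividesℕ c 2ᵉk≡cN) lvl = by-size (2 ℕ.^ e ℕ.* (k ℕ.* j)) ≡.refl S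
    where
    exponents : 2 ℕ.^ e ℕ.* (k ℕ.* j) ≡ N ℕ.* (c ℕ.* j)
    exponents = ≡.trans (≡.sym (ℕₚ.*-assoc (2 ℕ.^ e) k j)) (≡.trans (≡.cong (ℕ._* j) (≡.trans 2ᵉk≡cN (ℕₚ.*-comm c N))) (ℕₚ.*-assoc N c j))
    -- `unit-power≉1` expects a field of size q + 2; the unit group is non-empty because 2^e ≠ 0 and
    -- k j is odd.
    by-size : ∀ m → m ≡ 2 ℕ.^ e ℕ.* (k ℕ.* j) → Stage f (suc m) → ⊥
    by-size zero    0≡ _ with ℕₚ.m*n≡0⇒m≡0∨n≡0 (2 ℕ.^ e) (≡.sym 0≡)
    ... | inj₁ 2ᵉ≡0 = contradiction (ℕₚ.m^n≡0⇒m≡0 2 e 2ᵉ≡0) λ ()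
    ... | inj₂ kj≡0 = odd (≡.subst (2 ∣ℕ_) (≡.sym kj≡0) (dividesℕ 0 ≡.refl))
    by-size (suc q) q≡ S = unit-power≉1 S f-monic A g∣f^R f^R∣g (power⇒level S-g (suc q) F.1# (trans
      (trans (^-congʳ unit (≡.trans q≡ exponents)) (trans (sym (^-assocʳ unit N (c ℕ.* j)))
        (trans (^-congˡ (c ℕ.* j) (trans (level⇒power S-g N F.1# lvl) embed-1)) (1^n≈1 (c ℕ.* j)))))
      (sym embed-1)))
      where
      S-g : Stage g r
      S-g = Descent.stage S f-monic A g∣f^R
      open Stage S-g using (E; unit)
      open In E

  module Whole {f g d} (irr-f : Irr d f) (f^R-irr : Irreducible (f ^R)) (g≈f^R : g ≈ₚ f ^R) where
    g∣f^R : g ∣ f ^R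
    g∣f^R = record { quotient = F.1# ∷ [] ; equality = λ i → F.trans (at (*ₚ-identityˡ g) i) (g≈f^R i) }

    f^R∣g : f ^R ∣ g
    f^R∣g = record { quotient = F.1# ∷ [] ; equality = λ i → F.trans (at (*ₚ-identityˡ (f ^R)) i) (F.sym (g≈f^R i)) }

    g-monicOfDegree : MonicOfDegree g (2 ℕ.* d)
    g-monicOfDegree = ≡.subst (λ m → MonicOfDegree g (2 ℕ.* m)) (Irr.degree≡m irr-f)
      (MonicOfDegree-cong (f ^R) g (coeffwise λ i → F.sym (g≈f^R i)) (^R-monic f (Irr.monic irr-f)))

    g-irreducible : Irreducible g
    g-irreducible = record
      { p∤1 = λ { record { quotient = s ; equality = sg≈1 } → Irreducible.p∤1 f^R-irr record
          { quotient = s ; equality = λ i → F.trans (at (PR.*-congˡ {s} (PR.sym g≋f^R)) i) (sg≈1 i) } }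
      ; split-∣1 = λ {x} {y} g≈xy → Irreducible.split-∣1 f^R-irr {x} {y} (λ i → F.trans (F.sym (g≈f^R i)) (g≈xy i))
      }
      where
      module PR = CommutativeRing polynomialRing
      g≋f^R : g PR.≈ f ^R
      g≋f^R = coeffwise g≈f^R

    A : Adjunction g (p ℕ.^ (2 ℕ.* d))
    A = adjoin g-monicOfDegree g-irreducible

    g-monic : Monic g
    g-monic = MonicOfDegree⇒monic g (2 ℕ.* d) g-monicOfDegree

    degree-g : degree g ≡ 2 ℕ.* d
    degree-g = MonicOfDegree⇒degree g (2 ℕ.* d) g-monicOfDegree

  level⁻-suc : ∀ {g} a → Level g (2 ℕ.* (2 ℕ.^ a ℕ.* k)) (F.- F.1#) → Level⁻ (suc a) g
  level⁻-suc {g} a = ≡.subst (λ N → Level g N (F.- F.1#)) (≡.sym (ℕₚ.*-assoc 2 (2 ℕ.^ a) k))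

  advance : ∀ {f g d e a} → 0 < d → Order d e → State d a f → Successor f g →
            (suc a < e × State d (suc a) g) ⊎ (suc a ≡ e × State (2 ℕ.* d) (suc a) g)
  advance {f} {g} {d} {e} {a} 0<d o (irr-f , lvl) (factor _ g-monic g-irr deg g∣f^R) =
    inj₁ (level-bound {g} odd (stage-of-order 0<d irr-g o) lvl-g , irr-g , lvl-g)
    where
    open Order o
    deg≡d : degree g ≡ d
    deg≡d = ≡.trans deg (Irr.degree≡m irr-f)
    module D = Descent (irr⇒stage 0<d irr-f) (Irr.monic irr-f)
      (adjoin {g} (≡.subst (MonicOfDegree g) deg≡d (monic⇒MonicOfDegree g g-monic)) g-irr) g∣f^R
    irr-g : Irr d g
    irr-g = D.next-irr g-monic deg≡d g-irr
    lvl-g : Level⁻ (suc a) g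
    lvl-g = level⁻-suc {g} a (D.level-double (2 ℕ.^ a ℕ.* k) (F.- F.1#) lvl)
  advance {f} {g} {d} {e} {a} 0<d o (irr-f , lvl) (whole f^R-irr g≈f^R) =
    inj₂ (ℕₚ.≤-antisym (level-bound {f} odd S lvl) (ℕₚ.≮⇒≥ a+1≮e) , D.next-irr g-monic degree-g g-irreducible , lvl-g)
    where
    open Order o
    open Whole {f} {g} irr-f f^R-irr g≈f^R
    S = stage-of-order 0<d irr-f o
    module D = Descent S (Irr.monic irr-f) A g∣f^R
    lvl-g : Level⁻ (suc a) g
    lvl-g = level⁻-suc {g} a (D.level-double (2 ℕ.^ a ℕ.* k) (F.- F.1#) lvl)
    -- Otherwise 2^(a+2) k divides 2^e k, while squaring the level -1 of g shows that the unit of g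
    -- has this power equal to 1.
    a+1≮e : ¬ suc a < e
    a+1≮e a+1<e = order-bound {f} {g} {e} {cofactor} odd S (Irr.monic irr-f) A g∣f^R f^R∣g (2 ℕ.^ suc a ℕ.* k ℕ.* 2)
      (dividesℕ (2 ℕ.^ (e ∸ suc (suc a))) exponents) (level⁻-square D.stage (2 ℕ.^ suc a ℕ.* k) lvl-g)
      where
      rearrange : ∀ x y k → y ℕ.* (2 ℕ.* x) ℕ.* k ≡ y ℕ.* (x ℕ.* k ℕ.* 2)
      rearrange = solve-∀
      exponents : 2 ℕ.^ e ℕ.* k ≡ 2 ℕ.^ (e ∸ suc (suc a)) ℕ.* (2 ℕ.^ suc a ℕ.* k ℕ.* 2)
      exponents = ≡.trans (≡.cong (ℕ._* k) (≡.trans (≡.cong (2 ℕ.^_) (≡.sym (ℕₚ.m∸n+n≡m a+1<e))) (ℕₚ.^-distribˡ-+-* 2 (e ∸ suc (suc a)) (suc (suc a)))))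
        (rearrange (2 ℕ.^ suc a) (2 ℕ.^ (e ∸ suc (suc a))) k)

  initial-level : ∀ {f d} e → 0 < d → p ℕ.^ d ≡ suc (2 ℕ.^ e ℕ.* k) → Irr d f →
                  Level f k F.1# ⊎ ∃[ a ] (a < e × Level⁻ a f)
  initial-level {f} e 0<d pᵈ≡ irr = from-stage (≡.subst (Stage f) pᵈ≡ (irr⇒stage 0<d irr))
    where
    from-stage : Stage f (suc (2 ℕ.^ e ℕ.* k)) → Level f k F.1# ⊎ ∃[ a ] (a < e × Level⁻ a f)
    from-stage S = level-first-sign S e (fermat cardinality unit≉0)
      where
      open Stage S
      open In E

  -- The k-th power of the unit is a square root of 1; the value 1 would make every root of g
  -- periodic.
  escape-factor : ∀ {g q} → Stage g q → Level g (2 ℕ.* k) F.1# → HasNonPeriodicRoot g → Level⁻ 0 g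
  escape-factor {g} S lvl nonperiodic = by-sign (level-first-sign S 1 (trans (level⇒power S (2 ℕ.* k) F.1# lvl) embed-1))
    where
    open Stage S
    open In E
    by-sign : Level g k F.1# ⊎ ∃[ a ] (a < 1 × Level⁻ a g) → Level⁻ 0 g
    by-sign (inj₁ lvl′)                = contradiction nonperiodic (odd-order-root-periodic S lvl′)
    by-sign (inj₂ (zero , _ , lvl⁻))   = lvl⁻
    by-sign (inj₂ (suc a , s≤s () , _))

  -- Because 0 < e, 2k divides 2^e k, so `order-bound` excludes an irreducible `f ^R`. For a factor,
  -- the non-periodic root decides the sign.
  escape : ∀ {f g d e} → 0 < d → 0 < e → Order d e → Irr d f → Level f k F.1# → Successor f g →
           (¬ Irreducible (f ^R) → HasNonPeriodicRoot g) → State d 0 g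
  escape {f} {g} {d} {suc e} 0<d _ o irr-f lvl (whole f^R-irr g≈f^R) _ =
    contradiction (D.level-double k F.1# lvl)
      (order-bound {f} {g} {suc e} {cofactor} odd S (Irr.monic irr-f) A g∣f^R f^R∣g (2 ℕ.* k) (dividesℕ (2 ℕ.^ e) (rearrange (2 ℕ.^ e) k)))
    where
    open Order o
    open Whole {f} {g} irr-f f^R-irr g≈f^R
    S = stage-of-order 0<d irr-f o
    module D = Descent S (Irr.monic irr-f) A g∣f^R
    rearrange : ∀ x k → 2 ℕ.* x ℕ.* k ≡ x ℕ.* (2 ℕ.* k)
    rearrange = solve-∀
  escape {f} {g} {d} 0<d _ o irr-f lvl (factor ¬irr g-monic g-irr deg g∣f^R) nonperiodic =
    D.next-irr g-monic deg≡d g-irr , escape-factor D.stage (D.level-double k F.1# lvl) (nonperiodic ¬irr)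
    where
    deg≡d : degree g ≡ d
    deg≡d = ≡.trans deg (Irr.degree≡m irr-f)
    module D = Descent (irr⇒stage 0<d irr-f) (Irr.monic irr-f)
      (adjoin {g} (≡.subst (MonicOfDegree g) deg≡d (monic⇒MonicOfDegree g g-monic)) g-irr) g∣f^R

  module _ (f : ℕ → Poly) (successor : ∀ i → Successor (f i) (f (suc i))) where

    -- t + 1 is the distance from a to e. Each step of `advance` raises the level by one and doubles
    -- the degree exactly on reaching e, hence only at the last of these steps.
    run : ∀ {d e} → 0 < d → Order d e → ∀ t {a} i → a ℕ.+ suc t ≡ e → State d a (f i) →
          (∀ j → j ≤ t → Irr d (f (i ℕ.+ j))) × State (2 ℕ.* d) e (f (i ℕ.+ suc t))
    run {d} {e} 0<d o zero {a} i a+1≡e st@(irr , _) with advance 0<d o st (successor i)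
    ... | inj₁ (a+1<e , _)     = contradiction (≡.trans (ℕₚ.+-comm 1 a) a+1≡e) (ℕₚ.<⇒≢ a+1<e)
    ... | inj₂ (a+1≡e′ , next) =
      (λ { zero _ → ≡.subst (Irr d ∘ f) (≡.sym (ℕₚ.+-identityʳ i)) irr })
      , ≡.subst₂ (λ a i → State (2 ℕ.* d) a (f i)) a+1≡e′ (ℕₚ.+-comm 1 i) next
    run {d} {e} 0<d o (suc t) {a} i a+t≡e st@(irr , _) with advance 0<d o st (successor i)
    ... | inj₂ (a+1≡e , _)     = contradiction (≡.trans a+1≡e (≡.sym a+t≡e)) λ eq →
      ℕₚ.m≢1+m+n (suc a) (≡.trans eq (≡.trans (ℕₚ.+-suc a (suc t)) (≡.cong suc (ℕₚ.+-suc a t))))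
    ... | inj₁ (_ , next)
      with irrs , end ← run 0<d o t {suc a} (suc i) (≡.trans (≡.sym (ℕₚ.+-suc a (suc t))) a+t≡e) next
      = (λ { zero _ → ≡.subst (Irr d ∘ f) (≡.sym (ℕₚ.+-identityʳ i)) irr
           ; (suc j) (s≤s j≤t) → ≡.subst (Irr d ∘ f) (≡.sym (ℕₚ.+-suc i j)) (irrs j j≤t) })
        , ≡.subst (State (2 ℕ.* d) e ∘ f) (≡.sym (ℕₚ.+-suc i (suc t))) end

    -- The level e + j stays one below the valuation e + 1 + j, so the alternative of `advance` that
    -- keeps the degree is absurd at every step.
    double-forever : ∀ {d e i} → 0 < d → (∀ j → Order (2 ℕ.^ j ℕ.* d) (suc e ℕ.+ j)) → State d e (f i) →
                     ∀ j → State (2 ℕ.^ j ℕ.* d) (e ℕ.+ j) (f (i ℕ.+ j))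
    double-forever {d} {e} {i} 0<d orders st zero = ≡.subst₂ (λ a i → State (1 ℕ.* d) a (f i))
      (≡.sym (ℕₚ.+-identityʳ e)) (≡.sym (ℕₚ.+-identityʳ i)) (≡.subst (λ d → State d e (f i)) (≡.sym (ℕₚ.*-identityˡ d)) st)
    double-forever {d} {e} {i} 0<d orders st (suc j)
      with advance (ℕₚ.*-mono-< (ℕₚ.m^n>0 2 j) 0<d) (orders j) (double-forever 0<d orders st j) (successor (i ℕ.+ j))
    ... | inj₁ (lt , _)   = contradiction lt (ℕₚ.<-irrefl ≡.refl)
    ... | inj₂ (_ , next) = ≡.subst₂ (λ a i → State (2 ℕ.^ suc j ℕ.* d) a (f i)) (≡.sym (ℕₚ.+-suc e j)) (≡.sym (ℕₚ.+-suc i j))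
      (≡.subst (λ d′ → State d′ (suc (e ℕ.+ j)) (f (suc (i ℕ.+ j)))) (≡.sym (ℕₚ.*-assoc 2 (2 ℕ.^ j) d)) next)

    first-phase : ∀ {d e} → 0 < d → 0 < e → Order d e → p ℕ.^ d ≡ suc (2 ℕ.^ e ℕ.* k) → Irr d (f 0) →
                  (¬ Irreducible (f 0 ^R) → HasNonPeriodicRoot (f 1)) →
                  ∃[ s ] (0 < s × s ≤ e ℕ.+ 1 × (∀ i → i < s → Irr d (f i)) × State (2 ℕ.* d) e (f s))
    first-phase {d} {e} 0<d 0<e o pᵈ≡ irr₀ nonperiodic = by-level (initial-level {f 0} e 0<d pᵈ≡ irr₀)
      where
      by-level : Level (f 0) k F.1# ⊎ ∃[ a ] (a < e × Level⁻ a (f 0)) →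
                 ∃[ s ] (0 < s × s ≤ e ℕ.+ 1 × (∀ i → i < s → Irr d (f i)) × State (2 ℕ.* d) e (f s))
      -- Climbing from level a takes e - a steps.
      by-level (inj₂ (a , a<e , lvl))
        with irrs , st ← run 0<d o (e ∸ suc a) {a} 0 (≡.trans (ℕₚ.+-suc a (e ∸ suc a)) (ℕₚ.m+[n∸m]≡n a<e)) (irr₀ , lvl)
        = suc (e ∸ suc a) , s≤s z≤n
        , ℕₚ.≤-trans (s≤s (ℕₚ.m∸n≤m e (suc a))) (ℕₚ.≤-reflexive (ℕₚ.+-comm 1 e))
        , (λ i i<s → irrs i (ℕₚ.≤-pred i<s)) , st
      -- Odd order costs one step to escape to level 0, then e steps to climb: this is the extreme
      -- case e + 1.
      by-level (inj₁ lvl)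
        with irrs , st ← run 0<d o (e ∸ 1) {0} 1 (ℕₚ.m+[n∸m]≡n 0<e) (escape 0<d 0<e o irr₀ lvl (successor 0) nonperiodic)
        = suc (suc (e ∸ 1)) , s≤s z≤n
        , ℕₚ.≤-reflexive (≡.trans (≡.cong suc (ℕₚ.m+[n∸m]≡n 0<e)) (ℕₚ.+-comm 1 e))
        , (λ { zero _ → irr₀ ; (suc i) (s≤s i<) → irrs i (ℕₚ.≤-pred i<) }) , st

-- The ranges of degrees n, 2n and 2^(2+j) n

open import Data.Nat using (ℕ; suc; _+_; _*_; _∸_; _^_; _≤_; _<_)

theorem3p1 : (p : ℕ) → Prime p → 2 ∤ℕ p →
    (F : Field) → HasCardinality F p →
    let open Polynomials F hiding (_^_) in
    (n : ℕ) → 0 < n →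
    (e₀ e₁ : ℕ) → 0 < e₀ → 0 < e₁ → e₀ < e₁ →
    ν₂ (p ^ n ∸ 1) ≈ e₀ →
    ν₂ (p ^ (2 * n) ∸ 1) ≈ e₁ →
    (f : ℕ → Poly) →
    Irr n (f 0) →
    (∀ i → Successor (f i) (f (suc i))) →
    (¬ Irreducible (f 0 ^R) → HasNonPeriodicRoot (f 1)) →
    ∃[ s₁ ] ∃[ s₂ ]
    ( 0 < s₁
    × 0 < s₂
    × (∀ i → i < s₁ → Irr n (f i))
    × (∀ i → s₁ ≤ i → i < s₁ + s₂ → Irr (2 * n) (f i))
    × (∀ j → Irr (2 ^ (2 + j) * n) (f (s₁ + s₂ + j)))
    × s₁ ≤ e₀ + 1
    × s₂ ≡ e₁ ∸ e₀
    )
theorem3p1 p p-prime 2∤p F finite n 0<n e₀ e₁ 0<e₀ _ e₀<e₁ (k , 2∤k , pⁿ-1≡) (k₁ , 2∤k₁ , p²ⁿ-1≡) f irr₀ successor nonperiodic =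
  let s₁ , 0<s₁ , s₁≤ , below , st = first-phase f successor 0<n 0<e₀ order₀ (pᵈ≡ n pⁿ-1≡) irr₀ nonperiodic
      irrs , st′ = run f successor 0<2n order₁ t {e₀} s₁ e₀+suc-t≡e₁ st
  in
    s₁ , suc t , 0<s₁ , s≤s z≤n , below
    , (λ i s₁≤i i< → ≡.subst (Irr (2 * n) ∘ f) (ℕₚ.m+[n∸m]≡n s₁≤i)
        (irrs (i ∸ s₁) (ℕₚ.≤-pred (ℕₚ.+-cancelˡ-< s₁ (i ∸ s₁) (suc t) (≡.subst (_< s₁ + suc t) (≡.sym (ℕₚ.m+[n∸m]≡n s₁≤i)) i<)))))
    -- In degree 4n the sequence arrives with level e₁, one below ν₂(p^(4n) - 1) = e₁ + 1; since 2 ≤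
    -- e₁, the valuation keeps growing by one with each doubling.
    , (λ j → ≡.subst (λ d → Irr d (f (s₁ + suc t + j))) (fourfold (2 ^ j) n)
        (proj₁ (double-forever f successor {e = e₁} 0<4n (order-tower (ℕₚ.m≤n⇒m≤1+n 2≤e₁) (order-double 2≤e₁ order₁)) st′ j)))
    , s₁≤
    , ≡.trans (≡.sym (ℕₚ.m+n∸m≡n e₀ (suc t))) (≡.cong (_∸ e₀) e₀+suc-t≡e₁)
  where
  open Polynomials F hiding (_^_)
  open Dynamics F finite 2∤p 2∤k
  open Orders p k

  pᵈ≡ : ∀ d {m} → p ^ d ∸ 1 ≡ m → p ^ d ≡ suc m
  pᵈ≡ d eq = ≡.trans (≡.sym (ℕₚ.m+[n∸m]≡n (ℕₚ.m^n>0 p {{prime⇒nonZero p-prime}} d))) (≡.cong suc eq)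

  order₀ : Order n e₀
  order₀ = record
    { cofactor = 1
    ; order    = ≡.trans (pᵈ≡ n pⁿ-1≡) (≡.cong (λ x → suc (2 ^ e₀ * x)) (≡.sym (ℕₚ.*-identityʳ k)))
    ; odd      = ≡.subst (2 ∤ℕ_) (≡.sym (ℕₚ.*-identityʳ k)) 2∤k
    }

  -- p^n - 1 divides p^(2n) - 1, so its odd part k divides 2^e₁ k₁ and therefore k₁.
  order₁ : Order (2 * n) e₁
  order₁ with dividesℕ c k₁≡ck ← odd-divisor 2∤k e₁ (≡.subst (k ∣ℕ_) (ℕₚ.suc-injective (≡.trans (≡.sym (square-pred n (pᵈ≡ n pⁿ-1≡))) (pᵈ≡ (2 * n) p²ⁿ-1≡)))
      (∣m⇒∣m*n (2 + 2 ^ e₀ * k) (n∣m*n (2 ^ e₀)))) = record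
    { cofactor = c
    ; order    = ≡.trans (pᵈ≡ (2 * n) p²ⁿ-1≡) (≡.cong (λ x → suc (2 ^ e₁ * x)) k₁≡kc)
    ; odd      = ≡.subst (2 ∤ℕ_) k₁≡kc 2∤k₁
    }
    where
    k₁≡kc : k₁ ≡ k * c
    k₁≡kc = ≡.trans k₁≡ck (ℕₚ.*-comm c k)

  2≤e₁ : 2 ≤ e₁
  2≤e₁ = ℕₚ.≤-trans (s≤s 0<e₀) e₀<e₁

  0<2n : 0 < 2 * n
  0<2n = ℕₚ.<-≤-trans 0<n (ℕₚ.m≤m+n n (n + 0))

  0<4n : 0 < 2 * (2 * n)
  0<4n = ℕₚ.<-≤-trans 0<2n (ℕₚ.m≤m+n (2 * n) (2 * n + 0))

  t : ℕ
  t = e₁ ∸ suc e₀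

  e₀+suc-t≡e₁ : e₀ + suc t ≡ e₁
  e₀+suc-t≡e₁ = ≡.trans (ℕₚ.+-suc e₀ t) (ℕₚ.m+[n∸m]≡n e₀<e₁)

  fourfold : ∀ x n → x * (2 * (2 * n)) ≡ 2 * (2 * x) * n
  fourfold = solve-∀
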